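{- Let $n$ be a composite integer and let $\ell$ be the smallest prime factor of $n$. Then $C_q(n)=0$ if and only if $(q,n)=(2,9)$. If $(q,n)\neq(2,9)$, then $C_q(n)=1$ if and only if $(q,n)=(2,4)$, and moreover $$C_q(n)\ge \frac{q^n}{(2n)^{\ell}}.$$
   Context: $\mathbb{F}_q$ is the finite field with $q$ elements. A finite ring $S$ is a Carmichael ring if $S$ is not a field and $a^{|S|}=a$ for every $a\in S$. A polynomial $f\in\mathbb{F}_q[t]$ is a Carmichael polynomial if $\mathbb{F}_q[t]/(f)$ is a Carmichael ring. $C_q(n)$ denotes the number of monic Carmichael polynomials in $\mathbb{F}_q[t]$ of degree $n$. -}

module Defs where

open import Level using (_⊔_) renaming (suc to lsuc)
open import Algebra.Bundles using (Ring; CommutativeRing)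
import Algebra.Properties.CommutativeSemigroup as CommutativeSemigroupProperties
import Algebra.Properties.Ring as RingProperties
import Algebra.Properties.Semiring.Divisibility as SemiringDivisibility
import Algebra.Properties.Semiring.Exp as SemiringExp
open import Data.Fin.Base using (Fin)
open import Data.List.Base using (List; []; _∷_; map)
open import Data.Nat.Base as ℕ using (ℕ; zero; suc)
open import Data.Nat.Divisibility using () renaming (_∣_ to _∣ℕ_)
open import Data.Nat.Primality using (Prime)
open import Data.Product.Base using (Σ; ∃-syntax; _×_; _,_; proj₁)
open import Function.Base using (_on_)
open import Function.Bundles using (Inverse)
open import Relation.Binary.Bundles using (Setoid)
open import Relation.Binary.Structures using (IsEquivalence)
import Relation.Binary.Construct.On as On
import Relation.Binary.PropositionalEquality as ≡
import Relation.Binary.Reasoning.Setoid as SetoidReasoning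
open import Relation.Nullary.Negation.Core using (¬_)

_HasCardinality_ : ∀ {c ℓ} → Setoid c ℓ → ℕ → Set (c ⊔ ℓ)
S HasCardinality n = Inverse S (≡.setoid (Fin n))

IsSmallestPrimeFactor : ℕ → ℕ → Set
IsSmallestPrimeFactor l n =
  Prime l × l ∣ℕ n × (∀ p → Prime p → p ∣ℕ n → l ℕ.≤ p)

------------------------------------------------------------------------
-- Fields and Carmichael rings

module _ {c ℓ} (R : Ring c ℓ) where
  open Ring R
  open SemiringExp semiring using (_^_)

  IsField : Set (c ⊔ ℓ)
  IsField = (∀ x y → x * y ≈ y * x)
          × 1# ≉ 0#
          × (∀ x → x ≉ 0# → ∃[ y ] x * y ≈ 1#)

  IsCarmichaelRing : Set (c ⊔ ℓ)
  IsCarmichaelRing = ∃[ m ] setoid HasCardinality m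
                          × ¬ IsField
                          × (∀ a → a ^ m ≈ a)

record FiniteField c ℓ (q : ℕ) : Set (lsuc (c ⊔ ℓ)) where
  field
    commutativeRing : CommutativeRing c ℓ
  open CommutativeRing commutativeRing public
  field
    isField     : IsField ring
    cardinality : setoid HasCardinality q

------------------------------------------------------------------------
-- The quotient of a commutative ring by a principal ideal: same carrier,
-- equality is congruence modulo the generator.

module Quotient {c ℓ} (R : CommutativeRing c ℓ) (f : CommutativeRing.Carrier R) where
  open CommutativeRing R
  open SemiringDivisibility semiring using (_∣_; _,_; ∣-respʳ; _∣0)
  open RingProperties ring
    using (-‿distribˡ-*; -‿+-comm; -‿anti-homo-+; -‿involutive; x[y-z]≈xy-xz; [y-z]x≈yx-zx)
  open CommutativeSemigroupProperties +-commutativeSemigroup using (interchange)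
  open SetoidReasoning setoid

  infix 4 _≡f_
  _≡f_ : Carrier → Carrier → Set (c ⊔ ℓ)
  x ≡f y = f ∣ x - y

  private
    ∣-+ : ∀ {x y} → f ∣ x → f ∣ y → f ∣ x + y
    ∣-+ (a , af≈x) (b , bf≈y) =
      a + b , trans (distribʳ f a b) (+-cong af≈x bf≈y)

    ∣-neg : ∀ {x} → f ∣ x → f ∣ - x
    ∣-neg (a , af≈x) = - a , trans (sym (-‿distribˡ-* a f)) (-‿cong af≈x)

    ∣-mulˡ : ∀ z {x} → f ∣ x → f ∣ z * x
    ∣-mulˡ z (a , af≈x) = z * a , trans (*-assoc z a f) (*-congˡ af≈x)

    ∣-mulʳ : ∀ z {x} → f ∣ x → f ∣ x * z
    ∣-mulʳ z f∣x = ∣-respʳ (*-comm z _) (∣-mulˡ z f∣x)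

    neg-diff : ∀ x y → - (x - y) ≈ y - x
    neg-diff x y = trans (-‿anti-homo-+ x (- y)) (+-congʳ (-‿involutive y))

    telescope : ∀ x y z → (x - y) + (y - z) ≈ x - z
    telescope x y z = begin
      (x - y) + (y - z)    ≈⟨ +-assoc x (- y) (y - z) ⟩
      x + (- y + (y - z))  ≈⟨ +-congˡ (+-assoc (- y) y (- z)) ⟨
      x + ((- y + y) - z)  ≈⟨ +-congˡ (+-congʳ (-‿inverseˡ y)) ⟩
      x + (0# - z)         ≈⟨ +-congˡ (+-identityˡ (- z)) ⟩
      x - z                ∎

    reflexive′ : ∀ {x y} → x ≈ y → x ≡f y
    reflexive′ {x} {y} x≈y =
      ∣-respʳ (sym (trans (+-congʳ x≈y) (-‿inverseʳ y))) (f ∣0)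

    trans′ : ∀ {x y z} → x ≡f y → y ≡f z → x ≡f z
    trans′ {x} {y} {z} p q = ∣-respʳ (telescope x y z) (∣-+ p q)

    ≡f-isEquivalence : IsEquivalence _≡f_
    ≡f-isEquivalence = record
      { refl  = reflexive′ refl
      ; sym   = λ {x} {y} p → ∣-respʳ (neg-diff x y) (∣-neg p)
      ; trans = trans′
      }

    +-cong′ : ∀ {x y u v} → x ≡f y → u ≡f v → x + u ≡f y + v
    +-cong′ {x} {y} {u} {v} p q = ∣-respʳ eq (∣-+ p q)
      where
      eq : (x - y) + (u - v) ≈ (x + u) - (y + v)
      eq = trans (interchange x (- y) u (- v)) (+-congˡ (-‿+-comm y v))

    neg-cong′ : ∀ {x y} → x ≡f y → - x ≡f - y
    neg-cong′ {x} {y} p = ∣-respʳ (sym (-‿+-comm x (- y))) (∣-neg p)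

    *-cong′ : ∀ {x y u v} → x ≡f y → u ≡f v → x * u ≡f y * v
    *-cong′ {x} {y} {u} {v} p q = trans′
      (∣-respʳ ([y-z]x≈yx-zx u x y) (∣-mulʳ u p))
      (∣-respʳ (x[y-z]≈xy-xz y u v) (∣-mulˡ y q))

  quotientRing : CommutativeRing c (c ⊔ ℓ)
  quotientRing = record
    { Carrier = Carrier
    ; _≈_ = _≡f_
    ; _+_ = _+_
    ; _*_ = _*_
    ; -_  = -_
    ; 0#  = 0#
    ; 1#  = 1#
    ; isCommutativeRing = record
      { isRing = record
        { +-isAbelianGroup = record
          { isGroup = record
            { isMonoid = record
              { isSemigroup = record
                { isMagma = record
                  { isEquivalence = ≡f-isEquivalence
                  ; ∙-cong = +-cong′
                  }
                ; assoc = λ x y z → reflexive′ (+-assoc x y z)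
                }
              ; identity = (λ x → reflexive′ (+-identityˡ x))
                         , (λ x → reflexive′ (+-identityʳ x))
              }
            ; inverse = (λ x → reflexive′ (-‿inverseˡ x))
                      , (λ x → reflexive′ (-‿inverseʳ x))
            ; ⁻¹-cong = neg-cong′
            }
          ; comm = λ x y → reflexive′ (+-comm x y)
          }
        ; *-cong = *-cong′
        ; *-assoc = λ x y z → reflexive′ (*-assoc x y z)
        ; *-identity = (λ x → reflexive′ (*-identityˡ x))
                     , (λ x → reflexive′ (*-identityʳ x))
        ; distrib = (λ x y z → reflexive′ (distribˡ x y z))
                  , (λ x y z → reflexive′ (distribʳ x y z))
        }
      ; *-comm = λ x y → reflexive′ (*-comm x y)
      }
    }

------------------------------------------------------------------------
-- The polynomial ring R[t].  A polynomial is its list of coefficients,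
-- constant term first; trailing zeros are allowed, and equality compares
-- coefficients.

module Polynomial {c ℓ} (R : CommutativeRing c ℓ) where
  open CommutativeRing R
  open RingProperties ring using (-0#≈0#)
  open CommutativeSemigroupProperties +-commutativeSemigroup using (interchange)

  Poly : Set c
  Poly = List Carrier

  coeff : Poly → ℕ → Carrier
  coeff []      _       = 0#
  coeff (a ∷ p) zero    = a
  coeff (a ∷ p) (suc i) = coeff p i

  infix 4 _≈ₚ_
  record _≈ₚ_ (p q : Poly) : Set ℓ where
    constructor mk≈ₚ
    field
      coeff-≈ : ∀ i → coeff p i ≈ coeff q i
  open _≈ₚ_ public

  infixl 6 _+ₚ_
  infixl 7 _*ₚ_ _·ₚ_
  infix  8 -ₚ_

  _+ₚ_ : Poly → Poly → Poly
  []      +ₚ q       = q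
  (a ∷ p) +ₚ []      = a ∷ p
  (a ∷ p) +ₚ (b ∷ q) = (a + b) ∷ (p +ₚ q)

  -ₚ_ : Poly → Poly
  -ₚ p = map (-_) p

  _·ₚ_ : Carrier → Poly → Poly
  a ·ₚ p = map (a *_) p

  _*ₚ_ : Poly → Poly → Poly
  []      *ₚ q = []
  (a ∷ p) *ₚ q = a ·ₚ q +ₚ (0# ∷ (p *ₚ q))

  coeff-+ : ∀ p q i → coeff (p +ₚ q) i ≈ coeff p i + coeff q i
  coeff-+ []      q       i       = sym (+-identityˡ _)
  coeff-+ (a ∷ p) []      i       = sym (+-identityʳ _)
  coeff-+ (a ∷ p) (b ∷ q) zero    = refl
  coeff-+ (a ∷ p) (b ∷ q) (suc i) = coeff-+ p q i

  coeff-neg : ∀ p i → coeff (-ₚ p) i ≈ - coeff p i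
  coeff-neg []      i       = sym -0#≈0#
  coeff-neg (a ∷ p) zero    = refl
  coeff-neg (a ∷ p) (suc i) = coeff-neg p i

  coeff-· : ∀ a p i → coeff (a ·ₚ p) i ≈ a * coeff p i
  coeff-· a []      i       = sym (zeroʳ a)
  coeff-· a (b ∷ p) zero    = refl
  coeff-· a (b ∷ p) (suc i) = coeff-· a p i

  ≈ₚ-isEquivalence : IsEquivalence _≈ₚ_
  ≈ₚ-isEquivalence = record
    { refl  = mk≈ₚ λ _ → refl
    ; sym   = λ e → mk≈ₚ λ i → sym (coeff-≈ e i)
    ; trans = λ e e′ → mk≈ₚ λ i → trans (coeff-≈ e i) (coeff-≈ e′ i)
    }

  polySetoid : Setoid c ℓ
  polySetoid = record { isEquivalence = ≈ₚ-isEquivalence }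

  private
    module P = IsEquivalence ≈ₚ-isEquivalence
    module ≈R = SetoidReasoning setoid
    module ≈P = SetoidReasoning polySetoid

    ∷-cong : ∀ {a b p q} → a ≈ b → p ≈ₚ q → a ∷ p ≈ₚ b ∷ q
    ∷-cong a≈b p≈q = mk≈ₚ λ where
      zero    → a≈b
      (suc i) → coeff-≈ p≈q i

    tail≈ : ∀ {a b p q} → a ∷ p ≈ₚ b ∷ q → p ≈ₚ q
    tail≈ e = mk≈ₚ λ i → coeff-≈ e (suc i)

    0∷[]≈[] : 0# ∷ [] ≈ₚ []
    0∷[]≈[] = mk≈ₚ λ where
      zero    → refl
      (suc i) → refl

    +ₚ-cong : ∀ {p p′ q q′} → p ≈ₚ p′ → q ≈ₚ q′ → p +ₚ q ≈ₚ p′ +ₚ q′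
    +ₚ-cong {p} {p′} {q} {q′} e e′ = mk≈ₚ λ i → begin
      coeff (p +ₚ q) i          ≈⟨ coeff-+ p q i ⟩
      coeff p i + coeff q i     ≈⟨ +-cong (coeff-≈ e i) (coeff-≈ e′ i) ⟩
      coeff p′ i + coeff q′ i   ≈⟨ coeff-+ p′ q′ i ⟨
      coeff (p′ +ₚ q′) i        ∎
      where open ≈R

    +ₚ-assoc : ∀ p q r → (p +ₚ q) +ₚ r ≈ₚ p +ₚ (q +ₚ r)
    +ₚ-assoc p q r = mk≈ₚ λ i → begin
      coeff ((p +ₚ q) +ₚ r) i                ≈⟨ coeff-+ (p +ₚ q) r i ⟩
      coeff (p +ₚ q) i + coeff r i           ≈⟨ +-congʳ (coeff-+ p q i) ⟩
      coeff p i + coeff q i + coeff r i      ≈⟨ +-assoc _ _ _ ⟩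
      coeff p i + (coeff q i + coeff r i)    ≈⟨ +-congˡ (coeff-+ q r i) ⟨
      coeff p i + coeff (q +ₚ r) i           ≈⟨ coeff-+ p (q +ₚ r) i ⟨
      coeff (p +ₚ (q +ₚ r)) i                ∎
      where open ≈R

    +ₚ-comm : ∀ p q → p +ₚ q ≈ₚ q +ₚ p
    +ₚ-comm p q = mk≈ₚ λ i →
      trans (coeff-+ p q i) (trans (+-comm _ _) (sym (coeff-+ q p i)))

    +ₚ-identityʳ : ∀ p → p +ₚ [] ≈ₚ p
    +ₚ-identityʳ p = +ₚ-comm p []

    -ₚ-cong : ∀ {p q} → p ≈ₚ q → -ₚ p ≈ₚ -ₚ q
    -ₚ-cong {p} {q} e = mk≈ₚ λ i →
      trans (coeff-neg p i) (trans (-‿cong (coeff-≈ e i)) (sym (coeff-neg q i)))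

    -ₚ-inverseˡ : ∀ p → -ₚ p +ₚ p ≈ₚ []
    -ₚ-inverseˡ p = mk≈ₚ λ i →
      trans (coeff-+ (-ₚ p) p i) (trans (+-congʳ (coeff-neg p i)) (-‿inverseˡ _))

    +ₚ-interchange : ∀ p q r s → (p +ₚ q) +ₚ (r +ₚ s) ≈ₚ (p +ₚ r) +ₚ (q +ₚ s)
    +ₚ-interchange p q r s = mk≈ₚ λ i → begin
      coeff ((p +ₚ q) +ₚ (r +ₚ s)) i                          ≈⟨ coeff-+ (p +ₚ q) (r +ₚ s) i ⟩
      coeff (p +ₚ q) i + coeff (r +ₚ s) i                     ≈⟨ +-cong (coeff-+ p q i) (coeff-+ r s i) ⟩
      (coeff p i + coeff q i) + (coeff r i + coeff s i)       ≈⟨ interchange _ _ _ _ ⟩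
      (coeff p i + coeff r i) + (coeff q i + coeff s i)       ≈⟨ +-cong (coeff-+ p r i) (coeff-+ q s i) ⟨
      coeff (p +ₚ r) i + coeff (q +ₚ s) i                     ≈⟨ coeff-+ (p +ₚ r) (q +ₚ s) i ⟨
      coeff ((p +ₚ r) +ₚ (q +ₚ s)) i                          ∎
      where open ≈R

    +ₚ-swap : ∀ p q r → p +ₚ (q +ₚ r) ≈ₚ q +ₚ (p +ₚ r)
    +ₚ-swap p q r = P.trans (P.sym (+ₚ-assoc p q r))
      (P.trans (+ₚ-cong (+ₚ-comm p q) P.refl) (+ₚ-assoc q p r))

    ·ₚ-cong : ∀ {a b p q} → a ≈ b → p ≈ₚ q → a ·ₚ p ≈ₚ b ·ₚ q
    ·ₚ-cong {a} {b} {p} {q} a≈b e = mk≈ₚ λ i →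
      trans (coeff-· a p i) (trans (*-cong a≈b (coeff-≈ e i)) (sym (coeff-· b q i)))

    ·ₚ-zero : ∀ {a} p → a ≈ 0# → a ·ₚ p ≈ₚ []
    ·ₚ-zero {a} p a≈0 = mk≈ₚ λ i →
      trans (coeff-· a p i) (trans (*-congʳ a≈0) (zeroˡ _))

    ·ₚ-distribˡ : ∀ a p q → a ·ₚ (p +ₚ q) ≈ₚ a ·ₚ p +ₚ a ·ₚ q
    ·ₚ-distribˡ a p q = mk≈ₚ λ i → begin
      coeff (a ·ₚ (p +ₚ q)) i                 ≈⟨ coeff-· a (p +ₚ q) i ⟩
      a * coeff (p +ₚ q) i                    ≈⟨ *-congˡ (coeff-+ p q i) ⟩
      a * (coeff p i + coeff q i)             ≈⟨ distribˡ _ _ _ ⟩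
      a * coeff p i + a * coeff q i           ≈⟨ +-cong (coeff-· a p i) (coeff-· a q i) ⟨
      coeff (a ·ₚ p) i + coeff (a ·ₚ q) i     ≈⟨ coeff-+ (a ·ₚ p) (a ·ₚ q) i ⟨
      coeff (a ·ₚ p +ₚ a ·ₚ q) i              ∎
      where open ≈R

    ·ₚ-distribʳ : ∀ a b p → (a + b) ·ₚ p ≈ₚ a ·ₚ p +ₚ b ·ₚ p
    ·ₚ-distribʳ a b p = mk≈ₚ λ i → begin
      coeff ((a + b) ·ₚ p) i                  ≈⟨ coeff-· (a + b) p i ⟩
      (a + b) * coeff p i                     ≈⟨ distribʳ _ _ _ ⟩
      a * coeff p i + b * coeff p i           ≈⟨ +-cong (coeff-· a p i) (coeff-· b p i) ⟨
      coeff (a ·ₚ p) i + coeff (b ·ₚ p) i     ≈⟨ coeff-+ (a ·ₚ p) (b ·ₚ p) i ⟨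
      coeff (a ·ₚ p +ₚ b ·ₚ p) i              ∎
      where open ≈R

    ·ₚ-assoc : ∀ a b p → (a * b) ·ₚ p ≈ₚ a ·ₚ (b ·ₚ p)
    ·ₚ-assoc a b p = mk≈ₚ λ i → begin
      coeff ((a * b) ·ₚ p) i     ≈⟨ coeff-· (a * b) p i ⟩
      (a * b) * coeff p i        ≈⟨ *-assoc _ _ _ ⟩
      a * (b * coeff p i)        ≈⟨ *-congˡ (coeff-· b p i) ⟨
      a * coeff (b ·ₚ p) i       ≈⟨ coeff-· a (b ·ₚ p) i ⟨
      coeff (a ·ₚ (b ·ₚ p)) i    ∎
      where open ≈R

    ·ₚ-identity : ∀ p → 1# ·ₚ p ≈ₚ p
    ·ₚ-identity p = mk≈ₚ λ i → trans (coeff-· 1# p i) (*-identityˡ _)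

    *ₚ-zeroʳ : ∀ p → p *ₚ [] ≈ₚ []
    *ₚ-zeroʳ []      = P.refl
    *ₚ-zeroʳ (a ∷ p) = P.trans (∷-cong refl (*ₚ-zeroʳ p)) 0∷[]≈[]

    zero-*ₚ : ∀ p q → p ≈ₚ [] → p *ₚ q ≈ₚ []
    zero-*ₚ []      q e = P.refl
    zero-*ₚ (a ∷ p) q e = begin
      a ·ₚ q +ₚ (0# ∷ (p *ₚ q))
        ≈⟨ +ₚ-cong (·ₚ-zero q (coeff-≈ e 0))
                   (∷-cong refl (zero-*ₚ p q (mk≈ₚ λ i → coeff-≈ e (suc i)))) ⟩
      0# ∷ []
        ≈⟨ 0∷[]≈[] ⟩
      [] ∎
      where open ≈P

    *ₚ-congʳ : ∀ p p′ q → p ≈ₚ p′ → p *ₚ q ≈ₚ p′ *ₚ q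
    *ₚ-congʳ []      p′       q e = P.sym (zero-*ₚ p′ q (P.sym e))
    *ₚ-congʳ (a ∷ p) []       q e = zero-*ₚ (a ∷ p) q e
    *ₚ-congʳ (a ∷ p) (b ∷ p′) q e =
      +ₚ-cong (·ₚ-cong (coeff-≈ e 0) P.refl)
              (∷-cong refl (*ₚ-congʳ p p′ q (tail≈ e)))

    *ₚ-congˡ : ∀ p {q q′} → q ≈ₚ q′ → p *ₚ q ≈ₚ p *ₚ q′
    *ₚ-congˡ []      e = P.refl
    *ₚ-congˡ (a ∷ p) e = +ₚ-cong (·ₚ-cong refl e) (∷-cong refl (*ₚ-congˡ p e))

    *ₚ-cong : ∀ {p p′ q q′} → p ≈ₚ p′ → q ≈ₚ q′ → p *ₚ q ≈ₚ p′ *ₚ q′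
    *ₚ-cong {p} {p′} {q} e e′ = P.trans (*ₚ-congʳ p p′ q e) (*ₚ-congˡ p′ e′)

    0∷-+ₚ : ∀ p q → 0# ∷ (p +ₚ q) ≈ₚ (0# ∷ p) +ₚ (0# ∷ q)
    0∷-+ₚ p q = ∷-cong (sym (+-identityˡ 0#)) P.refl

    *ₚ-distribʳ : ∀ r p q → (p +ₚ q) *ₚ r ≈ₚ p *ₚ r +ₚ q *ₚ r
    *ₚ-distribʳ r []      q       = P.refl
    *ₚ-distribʳ r (a ∷ p) []      = P.sym (+ₚ-identityʳ _)
    *ₚ-distribʳ r (a ∷ p) (b ∷ q) = begin
      (a + b) ·ₚ r +ₚ (0# ∷ ((p +ₚ q) *ₚ r))
        ≈⟨ +ₚ-cong (·ₚ-distribʳ a b r) (∷-cong refl (*ₚ-distribʳ r p q)) ⟩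
      (a ·ₚ r +ₚ b ·ₚ r) +ₚ (0# ∷ (p *ₚ r +ₚ q *ₚ r))
        ≈⟨ +ₚ-cong P.refl (0∷-+ₚ (p *ₚ r) (q *ₚ r)) ⟩
      (a ·ₚ r +ₚ b ·ₚ r) +ₚ ((0# ∷ (p *ₚ r)) +ₚ (0# ∷ (q *ₚ r)))
        ≈⟨ +ₚ-interchange (a ·ₚ r) (b ·ₚ r) (0# ∷ (p *ₚ r)) (0# ∷ (q *ₚ r)) ⟩
      (a ∷ p) *ₚ r +ₚ (b ∷ q) *ₚ r ∎
      where open ≈P

    *ₚ-∷ : ∀ p b q → p *ₚ (b ∷ q) ≈ₚ b ·ₚ p +ₚ (0# ∷ (p *ₚ q))
    *ₚ-∷ []      b q = P.sym 0∷[]≈[]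
    *ₚ-∷ (a ∷ p) b q = ∷-cong (+-congʳ (*-comm a b)) (begin
      a ·ₚ q +ₚ p *ₚ (b ∷ q)                  ≈⟨ +ₚ-cong P.refl (*ₚ-∷ p b q) ⟩
      a ·ₚ q +ₚ (b ·ₚ p +ₚ (0# ∷ (p *ₚ q)))   ≈⟨ +ₚ-swap (a ·ₚ q) (b ·ₚ p) _ ⟩
      b ·ₚ p +ₚ (a ·ₚ q +ₚ (0# ∷ (p *ₚ q)))   ∎)
      where open ≈P

    *ₚ-comm : ∀ p q → p *ₚ q ≈ₚ q *ₚ p
    *ₚ-comm []      q = P.sym (*ₚ-zeroʳ q)
    *ₚ-comm (a ∷ p) q = P.trans
      (+ₚ-cong (P.refl {a ·ₚ q}) (∷-cong refl (*ₚ-comm p q)))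
      (P.sym (*ₚ-∷ q a p))

    ·ₚ-*ₚ : ∀ a p q → (a ·ₚ p) *ₚ q ≈ₚ a ·ₚ (p *ₚ q)
    ·ₚ-*ₚ a []      q = P.refl
    ·ₚ-*ₚ a (b ∷ p) q = begin
      (a * b) ·ₚ q +ₚ (0# ∷ ((a ·ₚ p) *ₚ q))
        ≈⟨ +ₚ-cong (·ₚ-assoc a b q) (∷-cong (sym (zeroʳ a)) (·ₚ-*ₚ a p q)) ⟩
      a ·ₚ (b ·ₚ q) +ₚ a ·ₚ (0# ∷ (p *ₚ q))
        ≈⟨ ·ₚ-distribˡ a (b ·ₚ q) (0# ∷ (p *ₚ q)) ⟨
      a ·ₚ (b ·ₚ q +ₚ (0# ∷ (p *ₚ q))) ∎
      where open ≈P

    *ₚ-assoc : ∀ p q r → (p *ₚ q) *ₚ r ≈ₚ p *ₚ (q *ₚ r)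
    *ₚ-assoc []      q r = P.refl
    *ₚ-assoc (a ∷ p) q r = begin
      (a ·ₚ q +ₚ (0# ∷ (p *ₚ q))) *ₚ r
        ≈⟨ *ₚ-distribʳ r (a ·ₚ q) (0# ∷ (p *ₚ q)) ⟩
      (a ·ₚ q) *ₚ r +ₚ (0# ·ₚ r +ₚ (0# ∷ ((p *ₚ q) *ₚ r)))
        ≈⟨ +ₚ-cong (·ₚ-*ₚ a q r)
                   (+ₚ-cong (·ₚ-zero r refl) (∷-cong refl (*ₚ-assoc p q r))) ⟩
      a ·ₚ (q *ₚ r) +ₚ (0# ∷ (p *ₚ (q *ₚ r))) ∎
      where open ≈P

    *ₚ-identityˡ : ∀ p → (1# ∷ []) *ₚ p ≈ₚ p
    *ₚ-identityˡ p = P.trans (+ₚ-cong (·ₚ-identity p) 0∷[]≈[]) (+ₚ-identityʳ p)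

  polyRing : CommutativeRing c ℓ
  polyRing = record
    { Carrier = Poly
    ; _≈_ = _≈ₚ_
    ; _+_ = _+ₚ_
    ; _*_ = _*ₚ_
    ; -_  = -ₚ_
    ; 0#  = []
    ; 1#  = 1# ∷ []
    ; isCommutativeRing = record
      { isRing = record
        { +-isAbelianGroup = record
          { isGroup = record
            { isMonoid = record
              { isSemigroup = record
                { isMagma = record
                  { isEquivalence = ≈ₚ-isEquivalence
                  ; ∙-cong = +ₚ-cong
                  }
                ; assoc = +ₚ-assoc
                }
              ; identity = (λ _ → P.refl) , +ₚ-identityʳ
              }
            ; inverse = -ₚ-inverseˡ
                      , (λ p → P.trans (+ₚ-comm p (-ₚ p)) (-ₚ-inverseˡ p))
            ; ⁻¹-cong = -ₚ-cong
            }
          ; comm = +ₚ-comm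
          }
        ; *-cong = *ₚ-cong
        ; *-assoc = *ₚ-assoc
        ; *-identity = *ₚ-identityˡ
                     , (λ p → P.trans (*ₚ-comm p (1# ∷ [])) (*ₚ-identityˡ p))
        ; distrib = (λ p q r → P.trans (*ₚ-comm p (q +ₚ r))
                       (P.trans (*ₚ-distribʳ p q r)
                                (+ₚ-cong (*ₚ-comm q p) (*ₚ-comm r p))))
                  , *ₚ-distribʳ
        }
      ; *-comm = *ₚ-comm
      }
    }

  IsMonicOfDegree : ℕ → Poly → Set ℓ
  IsMonicOfDegree n p = coeff p n ≈ 1# × (∀ i → n ℕ.< i → coeff p i ≈ 0#)

------------------------------------------------------------------------
-- Carmichael polynomials

module _ {c ℓ q} (F : FiniteField c ℓ q) where
  open Polynomial (FiniteField.commutativeRing F)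

  IsCarmichaelPolynomial : Poly → Set (c ⊔ ℓ)
  IsCarmichaelPolynomial f =
    IsCarmichaelRing (CommutativeRing.ring (Quotient.quotientRing polyRing f))

  -- Equality ignores the proof components, so the cardinality of this
  -- setoid counts polynomials.
  MonicCarmichael : ℕ → Setoid (c ⊔ ℓ) ℓ
  MonicCarmichael n = record
    { Carrier       = Σ Poly λ f → IsMonicOfDegree n f × IsCarmichaelPolynomial f
    ; _≈_           = _≈ₚ_ on proj₁
    ; isEquivalence = On.isEquivalence proj₁ ≈ₚ-isEquivalence
    }

{-# OPTIONS --safe #-}
module Submission where

-- A monic f of degree n is Carmichael iff it is reducible and a ^ (q ^ n) ≡ a mod f for all a, that
-- is, iff f is a product of at least two distinct primes whose degrees divide n.  With n = l m, the
-- products of l distinct primes of degree m already give C ≥ N choose l ≥ (N / l) ^ l, where N is the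
-- number of primes of degree m.
--
-- N is estimated without constructing extension fields: unique factorisation gives
-- m q ^ m = Σ_{deg f = m} deg f = Σ_{P,k} deg P · #{f : P ^ k ∣ f}, and subtracting q times the same
-- identity for m - 1 leaves Σ_{d ∣ m} d N_d = q ^ m, so that q ^ m + 2 ≤ m N + 2 q ^ ⌊m/2⌋.
-- This gives N > l except for q = 2 and (m, l) = (2, 2), (3, 2), (3, 3).  In the second of these
-- a product of primes of degrees 1, 2, 3 is a further Carmichael polynomial; in the other two n = p ²,
-- every prime factor of f has degree dividing p, so f divides t ^ (q ^ p) - t, which leaves at most
-- one f when n = 4 and none when n = 9.

open import Defs
open import Level using (_⊔_) renaming (suc to lsuc)
open import Algebra.Bundles using (CommutativeRing)
import Algebra.Properties.CommutativeMonoid.Sum as CommutativeMonoidSum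
import Algebra.Properties.CommutativeSemigroup as CommutativeSemigroupProperties
import Algebra.Properties.Group as GroupProperties
import Algebra.Properties.Ring as RingProperties
import Algebra.Properties.Semiring.Divisibility as SemiringDivisibility
import Algebra.Properties.Semiring.Exp as SemiringExp
import Algebra.Properties.Semiring.Sum as SemiringSum
open import Data.Empty using (⊥-elim)
open import Data.Fin.Base as Fin using (Fin; toℕ; fromℕ<; funToFin; finToFun)
open import Data.Fin.Permutation using (Permutation; permutation; _⟨$⟩ʳ_)
import Data.Fin.Properties as Fin
import Data.Integer.Base as ℤ
import Data.Integer.Properties as ℤ
open import Data.List.Base using (List; []; _∷_; _++_; length; map; filter; tabulate; allFin; lookup)
open import Data.List.Membership.Propositional.Properties using (∈-filter⁺; ∈-allFin; ∈-map⁺; ∈-lookup)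
import Data.List.Properties as List
open import Data.List.Relation.Unary.All as All using (All; []; _∷_)
import Data.List.Relation.Unary.All.Properties as All
open import Data.List.Relation.Unary.AllPairs as AllPairs using (AllPairs; []; _∷_)
import Data.List.Relation.Unary.AllPairs.Properties as AllPairs
open import Data.List.Relation.Unary.Any as Any using (Any)
import Data.List.Relation.Unary.Any.Properties as Any
import Data.List.Relation.Unary.Unique.Propositional.Properties as Unique
open import Data.Nat.Base as ℕ using (ℕ; zero; suc; z≤n; s≤s; NonZero; >-nonZero)
import Data.Nat.Divisibility as ℕ
open import Data.Nat.GCD using (gcd; gcd-GCD; module Bézout)
open import Data.Nat.Induction using (<-rec)
open import Data.Nat.Primality
  using (Prime; Composite; composite⇒nonZero; prime⇒nonTrivial; prime⇒¬composite; prime[2])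
open import Data.Nat.Primality.Factorisation using (factorise)
import Data.Nat.Properties as ℕ
open import Data.Nat.Tactic.RingSolver using (solve-∀)
open import Data.Product.Base using (Σ; ∃; ∃₂; _×_; _,_; proj₁; proj₂; uncurry)
import Data.Rational.Base as ℚ
import Data.Rational.Properties as ℚ
import Data.Rational.Unnormalised.Base as ℚᵘ
import Data.Rational.Unnormalised.Properties as ℚᵘ
open import Data.Sum.Base using (_⊎_; inj₁; inj₂)
open import Function.Base using (_∘_; _on_)
open import Function.Bundles using (Inverse; _⇔_; mk⇔)
open import Relation.Binary.Bundles using (Setoid)
import Relation.Binary.Construct.On as On
open import Relation.Binary.Definitions using (tri<; tri≈; tri>)
import Relation.Binary.PropositionalEquality as ≡
open ≡ using (_≡_; _≢_)
import Relation.Binary.Reasoning.Setoid as SetoidReasoning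
open import Relation.Nullary using (¬_; Dec; yes; no)
open import Relation.Nullary.Decidable using (map′; _×-dec_; _→-dec_; ¬?; from-yes)
open import Relation.Unary using (Pred; Decidable)
open SemiringSum ℕ.+-*-semiring
  using (sum; sum-cong-≗; ∑-comm; ∑-distrib-+; *-distribˡ-sum; *-distribʳ-sum)

-- Sums of natural numbers and binomial coefficients

-- The constant 2n arises as follows. Proper divisors of m are at most h = ⌊m/2⌋ and add at most q +
-- ... + q ^ h ≤ 2 q ^ h - 2 to Σ d N_d, and (q ^ h - 2)² ≥ 0 turns the resulting bound into q ^ m ≤
-- 2 m N. Hence (N / l) ^ l ≥ (q ^ m / (2 m l)) ^ l = q ^ n / (2n) ^ l. This chain rests on l ≤ N;
-- the strict inequality l < N makes the binomial coefficient exceed 1, so that C ≥ 2. Minimality of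
-- l enters twice: it gives l ≤ m, and it forces l = 2 when m is even, which settles q = 2, m = 4,
-- where N is only 3. C is obtained as the length of a list filtered from the q ^ n monic
-- polynomials, so primality and the Carmichael property must be decided. Euclid's algorithm decides
-- primality: run on f and every residue, it finds inverses for all nonzero residues or a proper
-- factor. Coefficient lists carry trailing zeros and so do not show their degree; `DegreeTheory`
-- hides them, and all later arguments take place in an abstract commutative ring.

module NatSums where
  open import Data.Nat.Base
  open import Data.Nat.Properties
  open ≡

  ⟦_⟧ : ∀ {a} {A : Set a} → Dec A → ℕ
  ⟦ yes _ ⟧ = 1
  ⟦ no  _ ⟧ = 0

  ⟦⟧-yes : ∀ {a} {A : Set a} (A? : Dec A) → A → ⟦ A? ⟧ ≡ 1
  ⟦⟧-yes (yes _) x = refl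
  ⟦⟧-yes (no ¬x) x = ⊥-elim (¬x x)

  ⟦⟧-no : ∀ {a} {A : Set a} (A? : Dec A) → ¬ A → ⟦ A? ⟧ ≡ 0
  ⟦⟧-no (yes x) ¬x = ⊥-elim (¬x x)
  ⟦⟧-no (no _)  ¬x = refl

  ⟦⟧-cong : ∀ {a b} {A : Set a} {B : Set b} (A? : Dec A) (B? : Dec B) →
            (A → B) → (B → A) → ⟦ A? ⟧ ≡ ⟦ B? ⟧
  ⟦⟧-cong (yes x) B? f g = sym (⟦⟧-yes B? (f x))
  ⟦⟧-cong (no ¬x) B? f g = sym (⟦⟧-no B? (¬x ∘ g))

  sum-zero : ∀ {n} (f : Fin n → ℕ) → (∀ i → f i ≡ 0) → sum f ≡ 0
  sum-zero {zero}  f h = refl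
  sum-zero {suc n} f h = cong₂ _+_ (h Fin.zero) (sum-zero (f ∘ Fin.suc) (h ∘ Fin.suc))

  sum-const : ∀ {n} (f : Fin n → ℕ) x → (∀ i → f i ≡ x) → sum f ≡ n * x
  sum-const {zero}  f x h = refl
  sum-const {suc n} f x h = cong₂ _+_ (h Fin.zero) (sum-const (f ∘ Fin.suc) x (h ∘ Fin.suc))

  sum-single : ∀ {n} (f : Fin n → ℕ) j → (∀ i → i ≢ j → f i ≡ 0) → sum f ≡ f j
  sum-single {suc n} f Fin.zero h =
    trans (cong (f Fin.zero +_) (sum-zero (f ∘ Fin.suc) (λ i → h (Fin.suc i) λ ()))) (+-identityʳ _)
  sum-single {suc n} f (Fin.suc j) h =
    cong₂ _+_ (h Fin.zero (λ ()))
      (sum-single (f ∘ Fin.suc) j (λ i i≢j → h (Fin.suc i) (i≢j ∘ Fin.suc-injective)))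

  term≤sum : ∀ {n} (f : Fin n → ℕ) j → f j ≤ sum f
  term≤sum {suc n} f Fin.zero    = m≤m+n _ _
  term≤sum {suc n} f (Fin.suc j) = ≤-trans (term≤sum (f ∘ Fin.suc) j) (m≤n+m _ _)

  -- `sum` unfolds at the first index, whereas inductions on an upper bound need the last term.
  sum-suc : ∀ n (f : ℕ → ℕ) → sum {suc n} (f ∘ toℕ) ≡ sum {n} (f ∘ toℕ) + f n
  sum-suc zero    f = +-identityʳ _
  sum-suc (suc n) f = trans (cong (f 0 +_) (sum-suc n (f ∘ suc))) (sym (+-assoc (f 0) _ _))

  sum-indicator≤1 : ∀ {p n} {P : Fin n → Set p} (P? : ∀ i → Dec (P i)) →
                    (∀ {i j} → P i → P j → i ≡ j) → sum (λ i → ⟦ P? i ⟧) ≤ 1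
  sum-indicator≤1 {n = zero}  P? h = z≤n
  sum-indicator≤1 {n = suc n} P? h with P? Fin.zero
  ... | yes p = ≤-reflexive (cong suc (sum-zero (λ i → ⟦ P? (Fin.suc i) ⟧)
                  (λ i → ⟦⟧-no (P? (Fin.suc i)) (λ p′ → Fin.0≢1+n (h p p′)))))
  ... | no  _ = sum-indicator≤1 (P? ∘ Fin.suc) (λ x y → Fin.suc-injective (h x y))

  -- Double counting of the pairs with `φ k ≡ i`: each `i` in `P` has one preimage, each `k` one
  -- image.
  sum-indicator-image : ∀ {p m n} {P : Fin n → Set p} (P? : ∀ i → Dec (P i)) (φ : Fin m → Fin n) →
    (∀ {i j} → φ i ≡ φ j → i ≡ j) → (∀ k → P (φ k)) → (∀ i → P i → ∃ λ k → φ k ≡ i) →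
    sum (λ i → ⟦ P? i ⟧) ≡ m
  sum-indicator-image {m = m} P? φ φ-inj sound complete = begin
    sum (λ i → ⟦ P? i ⟧)                       ≡⟨ sum-cong-≗ (λ i → sym (fibre i)) ⟩
    sum (λ i → sum (λ k → ⟦ φ k Fin.≟ i ⟧))    ≡⟨ ∑-comm (λ i k → ⟦ φ k Fin.≟ i ⟧) ⟩
    sum (λ k → sum (λ i → ⟦ φ k Fin.≟ i ⟧))    ≡⟨ sum-const (λ k → sum (λ i → ⟦ φ k Fin.≟ i ⟧)) 1 one ⟩
    m * 1                                      ≡⟨ *-identityʳ m ⟩
    m                                          ∎
    where
    open ≡-Reasoning
    fibre : ∀ i → sum (λ k → ⟦ φ k Fin.≟ i ⟧) ≡ ⟦ P? i ⟧
    fibre i with P? i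
    ... | yes p = let (k , e) = complete i p in
      trans (sum-single (λ k → ⟦ φ k Fin.≟ i ⟧) k
              (λ j j≢k → ⟦⟧-no (φ j Fin.≟ i) (λ e′ → j≢k (φ-inj (trans e′ (sym e))))))
            (⟦⟧-yes (φ k Fin.≟ i) e)
    ... | no ¬p = sum-zero (λ k → ⟦ φ k Fin.≟ i ⟧)
                    (λ k → ⟦⟧-no (φ k Fin.≟ i) (λ e → ¬p (subst _ e (sound k))))
    one : ∀ k → sum (λ i → ⟦ φ k Fin.≟ i ⟧) ≡ 1
    one k = trans (sum-single (λ i → ⟦ φ k Fin.≟ i ⟧) (φ k)
                    (λ i i≢ → ⟦⟧-no (φ k Fin.≟ i) (λ e → i≢ (sym e))))
                  (⟦⟧-yes (φ k Fin.≟ φ k) refl)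

  -- The number of monic multiples of degree m of a monic polynomial of degree j over F_q.
  multiples : (q m j : ℕ) → ℕ
  multiples q zero    zero    = 1
  multiples q zero    (suc j) = 0
  multiples q (suc m) zero    = q ^ suc m
  multiples q (suc m) (suc j) = multiples q m j

  multiples-≤ : ∀ q m j → j ≤ m → multiples q m j ≡ q ^ (m ∸ j)
  multiples-≤ q zero    zero    _   = refl
  multiples-≤ q (suc m) zero    _   = refl
  multiples-≤ q (suc m) (suc j) (s≤s j≤m) = multiples-≤ q m j j≤m

  multiples-> : ∀ q m j → m < j → multiples q m j ≡ 0
  multiples-> q zero    (suc j) _   = refl
  multiples-> q (suc m) (suc j) (s≤s m<j) = multiples-> q m j m<j

  -- The count q ^ (m - j) is multiplied by q when m grows by one, except at j = m + 1, where it
  -- jumps from 0 to 1. This correction is all that survives when q times the degree identity is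
  -- subtracted.
  multiples-suc : ∀ q m j → multiples q (suc m) j ≡ q * multiples q m j + ⟦ j ≟ suc m ⟧
  multiples-suc q zero    zero    = sym (+-identityʳ _)
  multiples-suc q (suc m) zero    = sym (+-identityʳ _)
  multiples-suc q zero (suc zero) rewrite *-zeroʳ q = refl
  multiples-suc q zero (suc (suc j)) rewrite *-zeroʳ q = refl
  multiples-suc q (suc m) (suc j) =
    trans (multiples-suc q m j)
          (cong (q * multiples q m j +_)
                (⟦⟧-cong (j ≟ suc m) (suc j ≟ suc (suc m)) (cong suc) suc-injective))

  -- Here c d stands for (d + 1) times the number of irreducibles of degree d + 1, and the
  -- hypothesis is the count of Σ_{deg f = m} deg f by prime powers dividing f.
  module Gauss (q : ℕ) (2≤q : 2 ≤ q) (M : ℕ) (c : ℕ → ℕ)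
    (degree-sum : ∀ m → m ≤ M →
      sum {M} (λ d → c (toℕ d) * sum {M} (λ k → multiples q m (suc (toℕ k) * suc (toℕ d)))) ≡ m * q ^ m)
    where

    instance
      q≢0 : NonZero q
      q≢0 = >-nonZero (≤-trans (s≤s z≤n) 2≤q)

    -- For 0 < m ≤ M this is the indicator of d + 1 dividing m, summed over the cofactor k + 1
    -- because `multiples-suc` produces it in that shape.
    exact : (m d : ℕ) → ℕ
    exact m d = sum {M} (λ k → ⟦ suc (toℕ k) * suc d ≟ m ⟧)

    private
      inner : ∀ m d → sum {M} (λ k → multiples q (suc m) (suc (toℕ k) * suc d))
                    ≡ q * sum {M} (λ k → multiples q m (suc (toℕ k) * suc d)) + exact (suc m) d
      inner m d = begin
        sum {M} (λ k → multiples q (suc m) (κ k))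
          ≡⟨ sum-cong-≗ (λ k → multiples-suc q m (κ k)) ⟩
        sum {M} (λ k → q * multiples q m (κ k) + ⟦ κ k ≟ suc m ⟧)
          ≡⟨ ∑-distrib-+ {M} (λ k → q * multiples q m (κ k)) (λ k → ⟦ κ k ≟ suc m ⟧) ⟩
        sum {M} (λ k → q * multiples q m (κ k)) + exact (suc m) d
          ≡⟨ cong (_+ exact (suc m) d) (sym (*-distribˡ-sum {M} q (λ k → multiples q m (κ k)))) ⟩
        q * sum {M} (λ k → multiples q m (κ k)) + exact (suc m) d ∎
        where
        open ≡-Reasoning
        κ : Fin M → ℕ
        κ k = suc (toℕ k) * suc d

    -- Gauss's identity Σ_{d ∣ m} d N_d = q ^ m, from the difference of two consecutive degree sums:
    -- (m + 1) q ^ (m + 1) - q · m q ^ m = q ^ (m + 1). Adding the subtrahend to both sides keeps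
    -- the argument in ℕ.
    divisor-sum : ∀ m → suc m ≤ M → sum {M} (λ d → c (toℕ d) * exact (suc m) (toℕ d)) ≡ q ^ suc m
    divisor-sum m m<M = +-cancelˡ-≡ (q * (m * q ^ m)) _ _ (begin
      q * (m * q ^ m) + sum {M} B
        ≡⟨ cong (λ z → q * z + sum {M} B) (sym (degree-sum m (<⇒≤ m<M))) ⟩
      q * sum {M} A + sum {M} B
        ≡⟨ cong (_+ sum {M} B) (*-distribˡ-sum {M} q A) ⟩
      sum {M} (λ d → q * A d) + sum {M} B
        ≡⟨ sym (∑-distrib-+ {M} (λ d → q * A d) B) ⟩
      sum {M} (λ d → q * A d + B d)
        ≡⟨ sum-cong-≗ {M} (λ d → trans (rearrange q (c (toℕ d)) (S d) (exact (suc m) (toℕ d)))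
                                (cong (c (toℕ d) *_) (sym (inner m (toℕ d))))) ⟩
      sum {M} (λ d → c (toℕ d) * sum {M} (λ k → multiples q (suc m) (suc (toℕ k) * suc (toℕ d))))
        ≡⟨ degree-sum (suc m) m<M ⟩
      suc m * q ^ suc m
        ≡⟨ regroup q m (q ^ m) ⟩
      q * (m * q ^ m) + q ^ suc m ∎)
      where
      open ≡-Reasoning
      S A B : Fin M → ℕ
      S d = sum {M} (λ k → multiples q m (suc (toℕ k) * suc (toℕ d)))
      A d = c (toℕ d) * S d
      B d = c (toℕ d) * exact (suc m) (toℕ d)
      rearrange : ∀ q c s e → q * (c * s) + c * e ≡ c * (q * s + e)
      rearrange = solve-∀
      regroup : ∀ q m x → suc m * (q * x) ≡ q * (m * x) + q * x
      regroup = solve-∀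

    -- d + 1 divides itself, so `c d` is one of the nonnegative terms of its own divisor sum.
    c≤ : ∀ d → d < M → c d ≤ q ^ suc d
    c≤ d d<M = begin
      c d                      ≡⟨ sym (*-identityʳ (c d)) ⟩
      c d * 1                  ≤⟨ *-monoʳ-≤ (c d) 1≤exact ⟩
      c d * exact (suc d) d    ≡⟨ cong (λ z → c z * exact (suc d) z) (sym (Fin.toℕ-fromℕ< d<M)) ⟩
      t (fromℕ< d<M)           ≤⟨ term≤sum t (fromℕ< d<M) ⟩
      sum t                    ≡⟨ divisor-sum d d<M ⟩
      q ^ suc d                ∎
      where
      open ≤-Reasoning
      t : Fin M → ℕ
      t e = c (toℕ e) * exact (suc d) (toℕ e)
      first : Fin M
      first = fromℕ< (≤-trans (s≤s z≤n) d<M)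
      1≤exact : 1 ≤ exact (suc d) d
      1≤exact = subst (_≤ exact (suc d) d)
        (⟦⟧-yes (suc (toℕ first) * suc d ≟ suc d)
          (trans (cong (λ z → suc z * suc d) (Fin.toℕ-fromℕ< (≤-trans (s≤s z≤n) d<M))) (+-identityʳ (suc d))))
        (term≤sum (λ k → ⟦ suc (toℕ k) * suc d ≟ suc d ⟧) first)

    exact≤1 : ∀ m d → exact m d ≤ 1
    exact≤1 m d = sum-indicator≤1 {n = M} (λ k → suc (toℕ k) * suc d ≟ m)
      (λ {i} {j} e e′ → Fin.toℕ-injective (suc-injective (*-cancelʳ-≡ _ _ (suc d) (trans e (sym e′)))))

    -- A proper divisor has cofactor at least 2, hence cannot exceed h when m < 2 (h + 1).
    exact≡0 : ∀ m h d → m < suc h + suc h → h ≤ d → suc d < m → exact m d ≡ 0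
    exact≡0 m h d m< h≤d d<m = sum-zero {M} _ λ k → ⟦⟧-no (suc (toℕ k) * suc d ≟ m) (absurd (toℕ k))
      where
      absurd : ∀ k → suc k * suc d ≢ m
      absurd zero    e = <⇒≢ d<m (trans (sym (+-identityʳ (suc d))) e)
      absurd (suc k) e = <⇒≱ m<
        (≤-trans (+-mono-≤ (s≤s h≤d) (≤-trans (s≤s h≤d) (m≤m+n (suc d) (k * suc d)))) (≤-reflexive e))

    -- Intended for h = ⌊(m + 1) / 2⌋. The top term of the divisor sum is kept, the terms between h
    -- and m vanish, and those up to h are bounded by a geometric series. Taking M = m + 1 makes the
    -- wanted term the last one.
    lower-bound : ∀ m h → M ≡ suc m → suc m < suc h + suc h → h ≤ m →
                  q ^ suc m + 2 ≤ c m + 2 * q ^ h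
    lower-bound m h refl m<2h h≤m = begin
      q ^ suc m + 2                    ≡⟨ cong (_+ 2) (sym (divisor-sum m ≤-refl)) ⟩
      sum {suc m} (g ∘ toℕ) + 2        ≡⟨ cong (_+ 2) (sum-suc m g) ⟩
      G m + g m + 2                    ≡⟨ rearrange (G m) (g m) ⟩
      g m + (G m + 2)                  ≤⟨ +-mono-≤ g≤c (large m h≤m ≤-refl) ⟩
      c m + 2 * q ^ h                  ∎
      where
      open ≤-Reasoning
      g : ℕ → ℕ
      g d = c d * exact (suc m) d
      G : ℕ → ℕ
      G K = sum {K} (g ∘ toℕ)
      g≤c : ∀ {d} → g d ≤ c d
      g≤c {d} = ≤-trans (*-monoʳ-≤ (c d) (exact≤1 (suc m) d)) (≤-reflexive (*-identityʳ (c d)))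
      rearrange : ∀ a b → a + b + 2 ≡ b + (a + 2)
      rearrange = solve-∀
      double : ∀ x → x + x ≡ 2 * x
      double = solve-∀
      -- The summand 2 closes the induction: q ^ (K + 1) + 2 q ^ K ≤ 2 q ^ (K + 1) because 2 ≤ q.
      small : ∀ K → K ≤ m → G K + 2 ≤ 2 * q ^ K
      small zero    _   = ≤-refl
      small (suc K) K<m = begin
        G (suc K) + 2            ≡⟨ cong (_+ 2) (sum-suc K g) ⟩
        G K + g K + 2            ≡⟨ rearrange (G K) (g K) ⟩
        g K + (G K + 2)          ≤⟨ +-mono-≤ (≤-trans g≤c (c≤ K (<⇒≤ (s≤s K<m)))) (small K (<⇒≤ K<m)) ⟩
        q ^ suc K + 2 * q ^ K    ≤⟨ +-monoʳ-≤ (q ^ suc K) (*-monoˡ-≤ (q ^ K) 2≤q) ⟩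
        q ^ suc K + q ^ suc K    ≡⟨ double (q ^ suc K) ⟩
        2 * q ^ suc K            ∎
      large : ∀ K → h ≤ K → K ≤ m → G K + 2 ≤ 2 * q ^ h
      large K h≤K K≤m with m≤n⇒m<n∨m≡n h≤K
      ... | inj₂ refl = small K K≤m
      large (suc K) h≤K K<m | inj₁ (s≤s h≤K′) = begin
        G (suc K) + 2            ≡⟨ cong (_+ 2) (sum-suc K g) ⟩
        G K + g K + 2            ≡⟨ cong (λ z → G K + z + 2) (trans (cong (c K *_) (exact≡0 (suc m) h K m<2h h≤K′ (s≤s K<m))) (*-zeroʳ (c K))) ⟩
        G K + 0 + 2              ≡⟨ cong (_+ 2) (+-identityʳ (G K)) ⟩
        G K + 2                  ≤⟨ large K h≤K′ (<⇒≤ K<m) ⟩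
        2 * q ^ h                ∎

  -- Lower bounds for binomial coefficients

  binomial : ℕ → ℕ → ℕ
  binomial n       zero    = 1
  binomial zero    (suc k) = 0
  binomial (suc n) (suc k) = binomial n k + binomial n (suc k)

  binomial-absorb : ∀ n k → suc k * binomial (suc n) (suc k) ≡ suc n * binomial n k
  binomial-absorb zero    zero    = refl
  binomial-absorb zero    (suc k) = *-zeroʳ k
  binomial-absorb (suc n) zero    = begin
    1 + binomial (suc n) 1 + 0      ≡⟨ cong (λ z → 1 + z) (binomial-absorb n zero) ⟩
    1 + suc n * 1                   ≡⟨ step n ⟩
    suc (suc n) * 1                 ∎
    where
    open ≡-Reasoning
    step : ∀ n → 1 + suc n * 1 ≡ suc (suc n) * 1
    step = solve-∀
  binomial-absorb (suc n) (suc k) = begin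
    (2 + k) * (b + (x + y))
      ≡⟨ split k b (x + y) ⟩
    (suc k * b + b) + (2 + k) * (x + y)
      ≡⟨ cong₂ (λ u v → u + b + v) (binomial-absorb n k) (binomial-absorb n (suc k)) ⟩
    suc n * binomial n k + b + suc n * binomial n (suc k)
      ≡⟨ join n (binomial n k) (binomial n (suc k)) ⟩
    (2 + n) * b ∎
    where
    open ≡-Reasoning
    b x y : ℕ
    b = binomial (suc n) (suc k)
    x = binomial n (suc k)
    y = binomial n (2 + k)
    split : ∀ k b z → (2 + k) * (b + z) ≡ (suc k * b + b) + (2 + k) * z
    split = solve-∀
    join : ∀ n u v → suc n * u + (u + v) + suc n * v ≡ (2 + n) * (u + v)
    join = solve-∀

  ^-distrib-* : ∀ a b k → (a * b) ^ k ≡ a ^ k * b ^ k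
  ^-distrib-* a b zero    = refl
  ^-distrib-* a b (suc k) = trans (cong (a * b *_) (^-distrib-* a b k)) (swap a b (a ^ k) (b ^ k))
    where
    swap : ∀ a b x y → a * b * (x * y) ≡ a * x * (b * y)
    swap = solve-∀

  -- The estimate (n / k) ^ k ≤ `binomial n k`, by induction along `binomial-absorb`: passing from
  -- (n, k) to (n + 1, k + 1) multiplies the coefficient by (n + 1) / (k + 1), and (n + 1) / (k + 1)
  -- ≤ n / k for 0 < k ≤ n. The factor `a ^ a` clears the denominators.
  ^≤^*binomial : ∀ k n → k ≤ n → n ^ k ≤ k ^ k * binomial n k
  ^≤^*binomial zero          n       _         = ≤-refl
  ^≤^*binomial (suc zero)    (suc n) _         = ≤-reflexive (begin
    suc n * 1                           ≡⟨ sym (binomial-absorb n zero) ⟩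
    1 * binomial (suc n) 1              ∎)
    where open ≡-Reasoning
  ^≤^*binomial (suc (suc k)) (suc n) (s≤s k<n) = *-cancelˡ-≤ (suc k ^ suc k) (begin
    a ^ a * (suc n * suc n ^ a)                        ≡⟨ shuffle (a ^ a) (suc n) (suc n ^ a) ⟩
    suc n * (a ^ a * suc n ^ a)                        ≡⟨ cong (suc n *_) (sym (^-distrib-* a (suc n) a)) ⟩
    suc n * (a * suc n) ^ a                            ≤⟨ *-monoʳ-≤ (suc n) (^-monoˡ-≤ a cross) ⟩
    suc n * (suc a * n) ^ a                            ≡⟨ cong (suc n *_) (^-distrib-* (suc a) n a) ⟩
    suc n * (suc a ^ a * n ^ a)                        ≤⟨ *-monoʳ-≤ (suc n) (*-monoʳ-≤ (suc a ^ a) (^≤^*binomial a n k<n)) ⟩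
    suc n * (suc a ^ a * (a ^ a * binomial n a))       ≡⟨ shuffle′ (suc n) (suc a ^ a) (a ^ a) (binomial n a) ⟩
    a ^ a * (suc a ^ a * (suc n * binomial n a))       ≡⟨ cong (λ z → a ^ a * (suc a ^ a * z)) (sym (binomial-absorb n a)) ⟩
    a ^ a * (suc a ^ a * (suc a * binomial (suc n) (suc a))) ≡⟨ cong (a ^ a *_) (shuffle″ (suc a ^ a) (suc a) (binomial (suc n) (suc a))) ⟩
    a ^ a * (suc a * suc a ^ a * binomial (suc n) (suc a)) ∎)
    where
    open ≤-Reasoning
    a : ℕ
    a = suc k
    instance
      a^a≢0 : NonZero (suc k ^ suc k)
      a^a≢0 = m^n≢0 (suc k) (suc k)
    cross : a * suc n ≤ suc a * n
    cross = begin
      a * suc n   ≡⟨ *-suc a n ⟩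
      a + a * n   ≤⟨ +-monoˡ-≤ (a * n) k<n ⟩
      n + a * n   ∎
    shuffle : ∀ x y z → x * (y * z) ≡ y * (x * z)
    shuffle = solve-∀
    shuffle′ : ∀ x y z w → x * (y * (z * w)) ≡ z * (y * (x * w))
    shuffle′ = solve-∀
    shuffle″ : ∀ x y z → x * (y * z) ≡ y * x * z
    shuffle″ = solve-∀

  -- In Pascal's rule one summand is at least n by induction and the other is positive. This yields
  -- two Carmichael polynomials as soon as there are more than l primes.
  n≤binomial : ∀ k n → 1 ≤ k → k < n → n ≤ binomial n k
  n≤binomial (suc zero)    (suc n) _ _         = ≤-reflexive (trans (sym (*-identityʳ (suc n)))
                                                   (trans (sym (binomial-absorb n 0)) (+-identityʳ _)))
  n≤binomial (suc (suc k)) (suc n) _ (s≤s k<n) =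
    subst (_≤ binomial (suc n) (suc (suc k))) (+-comm n 1)
      (+-mono-≤ (n≤binomial (suc k) n (s≤s z≤n) k<n) (positive (suc (suc k)) n k<n))
    where
    positive : ∀ k n → k ≤ n → 1 ≤ binomial n k
    positive zero    n       _         = ≤-refl
    positive (suc k) (suc n) (s≤s k≤n) = ≤-trans (positive k n k≤n) (m≤m+n _ _)

open NatSums

-- Finite fields and congruences

module Cardinality {c ℓ} (S : Setoid c ℓ) where
  open Setoid S

  card-unique : ∀ {m n} → S HasCardinality m → S HasCardinality n → m ≡ n
  card-unique A B = ℕ.≤-antisym (le A B) (le B A)
    where
    le : ∀ {m n} → S HasCardinality m → S HasCardinality n → m ℕ.≤ n
    le A B = Fin.injective⇒≤ {f = B.to ∘ A.from} λ {i} {j} e →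
      ≡.trans (≡.sym (A.strictlyInverseˡ i)) (≡.trans
        (A.to-cong (trans (sym (B.strictlyInverseʳ _)) (trans (B.from-cong e) (B.strictlyInverseʳ _))))
        (A.strictlyInverseˡ j))
      where
      module A = Inverse A
      module B = Inverse B

  module _ {n} (card : S HasCardinality n) where
    private module I = Inverse card

    to-injective : ∀ {x y} → I.to x ≡ I.to y → x ≈ y
    to-injective e = trans (sym (I.strictlyInverseʳ _)) (trans (I.from-cong e) (I.strictlyInverseʳ _))

    ≈-dec : ∀ x y → Dec (x ≈ y)
    ≈-dec x y with I.to x Fin.≟ I.to y
    ... | yes e = yes (to-injective e)
    ... | no ¬e = no (¬e ∘ I.to-cong)

module Fermat {c ℓ} (K : CommutativeRing c ℓ) (isField : IsField (CommutativeRing.ring K)) where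
  open CommutativeRing K
  open SemiringExp semiring using (_^_)
  open CommutativeSemigroupProperties *-commutativeSemigroup using (interchange)
  open CommutativeMonoidSum *-commutativeMonoid
    renaming (sum to product; sum-permute to product-permute; ∑-distrib-+ to product-distrib-*
             ; sum-cong-≋ to product-cong; sum-remove to product-remove; sum-replicate to product-replicate)
  open SetoidReasoning setoid

  private
    1≉0 : 1# ≉ 0#
    1≉0 = proj₁ (proj₂ isField)

    IsUnit : Carrier → Set (c ⊔ ℓ)
    IsUnit x = ∃ λ y → x * y ≈ 1#

    product-unit : ∀ {n} (t : Fin n → Carrier) → (∀ i → IsUnit (t i)) → IsUnit (product t)
    product-unit {zero}  t u = 1# , *-identityˡ 1#
    product-unit {suc n} t u =
      let (x , p) = u Fin.zero
          (y , r) = product-unit (t ∘ Fin.suc) (u ∘ Fin.suc)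
      in x * y , trans (interchange _ _ x y) (trans (*-cong p r) (*-identityˡ 1#))

  -- Multiplication by a ≠ 0 permutes the field; comparing the products of all elements, with 0
  -- replaced by 1 on both sides, gives a ^ (Q - 1) = 1.
  fermat : ∀ {Q} → setoid HasCardinality Q → ∀ a → a ^ Q ≈ a
  fermat {zero}  card a with () ← Inverse.to card a
  fermat {suc Q} card a with Cardinality.≈-dec setoid card a 0#
  ... | yes a≈0 = begin
    a * a ^ Q    ≈⟨ *-congʳ a≈0 ⟩
    0# * a ^ Q   ≈⟨ zeroˡ _ ⟩
    0#           ≈⟨ a≈0 ⟨
    a            ∎
  ... | no a≉0 = begin
    a * a ^ Q    ≈⟨ *-congˡ a^Q≈1 ⟩
    a * 1#       ≈⟨ *-identityʳ a ⟩
    a            ∎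
    where
    open Inverse card
    _≟0 : ∀ x → Dec (x ≈ 0#)
    x ≟0 = Cardinality.≈-dec setoid card x 0#

    b : Carrier
    b = proj₁ (proj₂ (proj₂ isField) a a≉0)
    ab≈1 : a * b ≈ 1#
    ab≈1 = proj₂ (proj₂ (proj₂ isField) a a≉0)
    ba≈1 : b * a ≈ 1#
    ba≈1 = trans (*-comm b a) ab≈1

    cancel : ∀ {u v} → u * v ≈ 1# → ∀ x → u * (v * x) ≈ x
    cancel uv x = trans (sym (*-assoc _ _ x)) (trans (*-congʳ uv) (*-identityˡ x))

    undo : ∀ {u v} → u * v ≈ 1# → ∀ i → to (u * from (to (v * from i))) ≡ i
    undo uv i = ≡.trans
      (to-cong (trans (*-congˡ (strictlyInverseʳ _)) (cancel uv (from i))))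
      (strictlyInverseˡ i)

    π : Permutation (suc Q) (suc Q)
    π = permutation (λ i → to (a * from i)) (λ i → to (b * from i)) (undo ab≈1) (undo ba≈1)

    nonzeroPart : Carrier → Carrier
    nonzeroPart x with x ≟0
    ... | yes _ = 1#
    ... | no  _ = x

    nonzeroPart-cong : ∀ {x y} → x ≈ y → nonzeroPart x ≈ nonzeroPart y
    nonzeroPart-cong {x} {y} e with x ≟0 | y ≟0
    ... | yes _ | yes _ = refl
    ... | yes p | no ¬p = ⊥-elim (¬p (trans (sym e) p))
    ... | no ¬p | yes p = ⊥-elim (¬p (trans e p))
    ... | no _  | no _  = e

    nonzeroPart-unit : ∀ x → IsUnit (nonzeroPart x)
    nonzeroPart-unit x with x ≟0
    ... | yes _ = 1# , *-identityˡ 1#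
    ... | no ¬p = proj₂ (proj₂ isField) x ¬p

    g h : Fin (suc Q) → Carrier
    g i = nonzeroPart (from i)
    i₀ : Fin (suc Q)
    i₀ = to 0#
    -- `h` is the pointwise ratio between the permuted and the original product. At the index of 0
    -- both products carry 1, so the ratio there is 1, which leaves exactly Q factors `a`.
    h i with i Fin.≟ i₀
    ... | yes _ = 1#
    ... | no  _ = a

    h-i₀ : h i₀ ≈ 1#
    h-i₀ with i₀ Fin.≟ i₀
    ... | yes _ = refl
    ... | no ¬e = ⊥-elim (¬e ≡.refl)

    h-other : ∀ j → h (Fin.punchIn i₀ j) ≈ a
    h-other j with Fin.punchIn i₀ j Fin.≟ i₀
    ... | yes e = ⊥-elim (Fin.punchInᵢ≢i i₀ j e)
    ... | no  _ = refl

    scaled : ∀ i → g (π ⟨$⟩ʳ i) ≈ h i * g i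
    scaled i = trans (nonzeroPart-cong (strictlyInverseʳ (a * from i))) (go i)
      where
      go : ∀ i → nonzeroPart (a * from i) ≈ h i * g i
      go i with i Fin.≟ i₀ | from i ≟0 | (a * from i) ≟0
      ... | yes _ | yes _ | yes _ = sym (*-identityˡ 1#)
      ... | yes e | no ¬p | _     = ⊥-elim (¬p (trans (from-cong e) (strictlyInverseʳ 0#)))
      ... | yes _ | yes p | no ¬r = ⊥-elim (¬r (trans (*-congˡ p) (zeroʳ a)))
      ... | no ¬e | yes p | _     = ⊥-elim (¬e (≡.trans (≡.sym (strictlyInverseˡ i)) (to-cong p)))
      ... | no _  | no ¬p | yes r = ⊥-elim (¬p (trans (sym (cancel ba≈1 (from i))) (trans (*-congˡ r) (zeroʳ b))))
      ... | no _  | no _  | no _  = refl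

    product-h : product h ≈ 1#
    product-h = let (u , gu≈1) = product-unit g (λ i → nonzeroPart-unit (from i)) in begin
      product h                      ≈⟨ *-identityʳ _ ⟨
      product h * 1#                 ≈⟨ *-congˡ gu≈1 ⟨
      product h * (product g * u)    ≈⟨ *-assoc _ _ u ⟨
      product h * product g * u      ≈⟨ *-congʳ (product-distrib-* h g) ⟨
      product (λ i → h i * g i) * u  ≈⟨ *-congʳ (product-cong (λ i → sym (scaled i))) ⟩
      product (λ i → g (π ⟨$⟩ʳ i)) * u ≈⟨ *-congʳ (product-permute g π) ⟨
      product g * u                  ≈⟨ gu≈1 ⟩
      1#                             ∎

    a^Q≈1 : a ^ Q ≈ 1#
    a^Q≈1 = begin
      a ^ Q                                        ≈⟨ product-replicate Q ⟨
      product {Q} (λ _ → a)                        ≈⟨ product-cong h-other ⟨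
      product (λ j → h (Fin.punchIn i₀ j))         ≈⟨ *-identityˡ _ ⟨
      1# * product (λ j → h (Fin.punchIn i₀ j))    ≈⟨ *-congʳ h-i₀ ⟨
      h i₀ * product (λ j → h (Fin.punchIn i₀ j))  ≈⟨ product-remove {i = i₀} h ⟨
      product h                                    ≈⟨ product-h ⟩
      1#                                           ∎

-- Congruences, prime moduli, and exponents that fix a modulus

module Congruences {c ℓ} (R : CommutativeRing c ℓ) where
  open CommutativeRing R
  open SemiringDivisibility semiring public
    using (_∣_; _∤_; _,_)
    renaming (∣ʳ-refl to ∣-refl; ∣ʳ-trans to ∣-trans; ∣ʳ-respʳ-≈ to ∣-respʳ; ∣ʳ-respˡ-≈ to ∣-respˡ)
  open SemiringExp semiring public using (_^_; ^-assocʳ)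
  open RingProperties ring using (-0#≈0#)
  module Mod (f : Carrier) = CommutativeRing (Quotient.quotientRing R f)

  infix 4 _≡_[mod_]
  _≡_[mod_] : Carrier → Carrier → Carrier → Set (c ⊔ ℓ)
  x ≡ y [mod f ] = Mod._≈_ f x y

  x-0≈x : ∀ x → x - 0# ≈ x
  x-0≈x x = trans (+-congˡ -0#≈0#) (+-identityʳ x)

  ∣⇒≡0 : ∀ {f x} → f ∣ x → x ≡ 0# [mod f ]
  ∣⇒≡0 {f} {x} = ∣-respʳ (sym (x-0≈x x))

  ≡0⇒∣ : ∀ {f x} → x ≡ 0# [mod f ] → f ∣ x
  ≡0⇒∣ {f} {x} = ∣-respʳ (x-0≈x x)

  ≈⇒≡ : ∀ {f x y} → x ≈ y → x ≡ y [mod f ]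
  ≈⇒≡ {f} {x} {y} e = 0# , trans (zeroˡ f) (sym (trans (+-congʳ e) (-‿inverseʳ y)))

  ≡-mono : ∀ {f g x y} → g ∣ f → x ≡ y [mod f ] → x ≡ y [mod g ]
  ≡-mono = ∣-trans

  ∣-resp-≡ : ∀ {f x y} → x ≡ y [mod f ] → f ∣ x → f ∣ y
  ∣-resp-≡ {f} e f∣x = ≡0⇒∣ (Mod.trans f (Mod.sym f e) (∣⇒≡0 f∣x))

  ∣-* : ∀ {f x} z → f ∣ x → f ∣ z * x
  ∣-* z (a , e) = z * a , trans (*-assoc z a _) (*-congˡ e)

  *-monoʳ-∣ : ∀ {f g} z → f ∣ g → f * z ∣ g * z
  *-monoʳ-∣ z (a , e) = a , trans (sym (*-assoc a _ z)) (*-congʳ e)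

  Mod-^ : ∀ f x n → SemiringExp._^_ (Mod.semiring f) x n ≡ x ^ n
  Mod-^ f x zero    = ≡.refl
  Mod-^ f x (suc n) = ≡.cong (x *_) (Mod-^ f x n)

  ^-cong-mod : ∀ {f x y} n → x ≡ y [mod f ] → x ^ n ≡ y ^ n [mod f ]
  ^-cong-mod {f} {x} {y} n e =
    ≡.subst₂ (λ u v → u ≡ v [mod f ]) (Mod-^ f x n) (Mod-^ f y n)
      (SemiringExp.^-congˡ (Mod.semiring f) n e)

  -- Primality is the field property of the quotient: its negation is a clause of the Carmichael
  -- condition, `Fermat.fermat` applies to it directly, and inverses modulo `P` give Euclid's lemma.
  PrimeModulus : Carrier → Set (c ⊔ ℓ)
  PrimeModulus P = IsField (Mod.ring P)

  prime-resp : ∀ {f g} → f ∣ g → g ∣ f → PrimeModulus f → PrimeModulus g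
  prime-resp {f} {g} f∣g g∣f (_ , 1≉0 , inverse) =
    Mod.*-comm g , 1≉0 ∘ ≡-mono f∣g , λ x x≉0 →
      let (y , e) = inverse x (x≉0 ∘ ≡-mono g∣f) in y , ≡-mono g∣f e

  euclid : ∀ {P a b} → PrimeModulus P → P ∤ a → P ∣ a * b → P ∣ b
  euclid {P} {a} {b} (_ , _ , inverse) P∤a P∣ab =
    let (y , ay≡1) = inverse a (P∤a ∘ ≡0⇒∣) in
    ≡0⇒∣ (begin
      b              ≈⟨ Mod.*-identityˡ P b ⟨
      1# * b         ≈⟨ Mod.*-congʳ P ay≡1 ⟨
      a * y * b      ≈⟨ Mod.*-congʳ P (Mod.*-comm P a y) ⟩
      y * a * b      ≈⟨ Mod.*-assoc P y a b ⟩
      y * (a * b)    ≈⟨ Mod.*-congˡ P (∣⇒≡0 P∣ab) ⟩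
      y * 0#         ≈⟨ Mod.zeroʳ P y ⟩
      0#             ∎)
    where open SetoidReasoning (Mod.setoid P)

  prime-*-∣ : ∀ {P h x} → PrimeModulus P → P ∤ h → P ∣ x → h ∣ x → P * h ∣ x
  prime-*-∣ {P} {h} {x} prime P∤h P∣x (s , sh≈x) =
    let (t , tP≈s) = euclid prime P∤h (∣-respʳ (trans (sym sh≈x) (*-comm s h)) P∣x) in
    t , trans (sym (*-assoc t P h)) (trans (*-congʳ tP≈s) sh≈x)

  Fixes : ℕ → Carrier → Set (c ⊔ ℓ)
  Fixes e f = ∀ a → a ^ e ≡ a [mod f ]

  fixes-prime-* : ∀ e {P h} → PrimeModulus P → P ∤ h → Fixes e P → Fixes e h → Fixes e (P * h)
  fixes-prime-* e prime P∤h fixP fixh a = prime-*-∣ prime P∤h (fixP a) (fixh a)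

  fixes-∣ : ∀ e {f g} → g ∣ f → Fixes e f → Fixes e g
  fixes-∣ e g∣f fix a = ≡-mono g∣f (fix a)

  fixes-* : ∀ {f} d e → Fixes d f → Fixes e f → Fixes (d ℕ.* e) f
  fixes-* {f} d e fixd fixe a = Mod.trans f (≈⇒≡ (sym (^-assocʳ a d e)))
    (Mod.trans f (^-cong-mod e (fixd a)) (fixe a))

  -- a ^ e ≡ (a ^ d) ^ e = a ^ (d e) ≡ a. For powers of q this subtracts exponents, which is what
  -- Bézout's identity over ℕ calls for.
  fixes-*-cancel : ∀ {f} d e → Fixes d f → Fixes (d ℕ.* e) f → Fixes e f
  fixes-*-cancel {f} d e fixd fix a = Mod.trans f (Mod.sym f (^-cong-mod e (fixd a)))
    (Mod.trans f (≈⇒≡ (^-assocʳ a d e)) (fix a))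

  fixes-1 : ∀ {f} → Fixes 1 f
  fixes-1 a = ≈⇒≡ (*-identityʳ a)

  module _ {f : Carrier} (q : ℕ) where

    fixes-multiple : ∀ k d → Fixes (q ℕ.^ d) f → Fixes (q ℕ.^ (k ℕ.* d)) f
    fixes-multiple zero    d fix = fixes-1
    fixes-multiple (suc k) d fix = ≡.subst (λ e → Fixes e f) (≡.sym (ℕ.^-distribˡ-+-* q d (k ℕ.* d)))
      (fixes-* (q ℕ.^ d) (q ℕ.^ (k ℕ.* d)) fix (fixes-multiple k d fix))

    fixes-∣-exponent : ∀ {d n} → d ℕ.∣ n → Fixes (q ℕ.^ d) f → Fixes (q ℕ.^ n) f
    fixes-∣-exponent (ℕ.divides k ≡.refl) fix = fixes-multiple k _ fix

    -- Bézout gives gcd + y n = x m, or the same with the roles of m and n exchanged. Then q ^ (x m)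
    -- = q ^ (y n) · q ^ gcd, and the first factor cancels. This stands in for intersecting the
    -- fields of q ^ m and q ^ n elements.
    fixes-gcd : ∀ m n → Fixes (q ℕ.^ m) f → Fixes (q ℕ.^ n) f → Fixes (q ℕ.^ gcd m n) f
    fixes-gcd m n fixm fixn with Bézout.identity (gcd-GCD m n)
    ... | Bézout.+- x y e = fixes-*-cancel (q ℕ.^ (y ℕ.* n)) _ (fixes-multiple y n fixn)
            (≡.subst (λ z → Fixes z f)
              (≡.trans (≡.cong (q ℕ.^_) (≡.trans (≡.sym e) (ℕ.+-comm _ (y ℕ.* n))))
                       (ℕ.^-distribˡ-+-* q (y ℕ.* n) _))
              (fixes-multiple x m fixm))
    ... | Bézout.-+ x y e = fixes-*-cancel (q ℕ.^ (x ℕ.* m)) _ (fixes-multiple x m fixm)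
            (≡.subst (λ z → Fixes z f)
              (≡.trans (≡.cong (q ℕ.^_) (≡.trans (≡.sym e) (ℕ.+-comm _ (x ℕ.* m))))
                       (ℕ.^-distribˡ-+-* q (x ℕ.* m) _))
              (fixes-multiple y n fixn))

  -- P ^ (2 + e) is divisible by P² and congruent to P modulo P². For a nonconstant monic P the
  -- conclusion contradicts degrees, so a fixed modulus is squarefree.
  square-∣-fixes : ∀ e {f P} → Fixes (2 ℕ.+ e) f → P * P ∣ f → P * P ∣ P
  square-∣-fixes e {f} {P} fix P²∣f = ∣-resp-≡ (≡-mono P²∣f (fix P))
    (P ^ e , trans (*-comm (P ^ e) (P * P)) (*-assoc P P (P ^ e)))

-- The degree theory of a polynomial ring

-- A finite search: each index yields evidence for `A` or a counterexample `B` of one fixed kind,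
-- here a factorisation of the modulus.
all-or : ∀ {a b n} {A : Fin n → Set a} {B : Set b} → (∀ i → A i ⊎ B) → (∀ i → A i) ⊎ B
all-or {n = zero}  h = inj₁ λ ()
all-or {n = suc n} h with h Fin.zero | all-or (h ∘ Fin.suc)
... | inj₂ b | _      = inj₂ b
... | inj₁ _ | inj₂ b = inj₂ b
... | inj₁ a | inj₁ f = inj₁ λ { Fin.zero → a ; (Fin.suc i) → f i }

funToFin-cong : ∀ {m n} {f g : Fin m → Fin n} → (∀ i → f i ≡ g i) → funToFin f ≡ funToFin g
funToFin-cong {zero}  h = ≡.refl
funToFin-cong {suc m} h = ≡.cong₂ Fin.combine (h Fin.zero) (funToFin-cong (h ∘ Fin.suc))

-- The properties of F_q[t] on which the argument rests.  Low n x means deg x < n; both the elements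
-- of degree < n and the monic ones of degree n are indexed by Fin (q ^ n) through encode.
record DegreeTheory {c ℓ} (R : CommutativeRing c ℓ) (q : ℕ) : Set (lsuc c ⊔ lsuc ℓ) where
  open CommutativeRing R
  open Congruences R using (_∣_)
  field
    1<q   : 1 ℕ.< q
    _≈?_  : ∀ x y → Dec (x ≈ y)
    Low   : ℕ → Carrier → Set ℓ
    Monic : ℕ → Carrier → Set ℓ

    low-resp : ∀ {n x y} → x ≈ y → Low n x → Low n y
    0-low    : ∀ {n} → Low n 0#
    low-+    : ∀ {n x y} → Low n x → Low n y → Low n (x + y)
    low-neg  : ∀ {n x} → Low n x → Low n (- x)

    monic-resp          : ∀ {n x y} → x ≈ y → Monic n x → Monic n y
    monic-1             : Monic 0 1#
    monic-0⇒1           : ∀ {x} → Monic 0 x → x ≈ 1#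
    monic-*             : ∀ {m n x y} → Monic m x → Monic n y → Monic (m ℕ.+ n) (x * y)
    monic⇒low           : ∀ {m n x} → m ℕ.< n → Monic m x → Low n x
    monic-+-low         : ∀ {n x y} → Monic n x → Low n y → Monic n (x + y)
    monic-degree-unique : ∀ {m n x} → Monic m x → Monic n x → m ≡ n

    normalise : ∀ {n x} → Low n x →
                x ≈ 0# ⊎ ∃ λ d → d ℕ.< n × ∃₂ λ u v → u * v ≈ 1# × Monic d (u * x)
    divide    : ∀ {n f} → Monic n f → ∀ x → ∃₂ λ s r → Low n r × s * f + r ≈ x

    monic-∣-low    : ∀ {n f r} → Monic n f → Low n r → f ∣ r → r ≈ 0#
    monic-cancelʳ  : ∀ {n f x y} → Monic n f → x * f ≈ y * f → x ≈ y
    quotient-monic : ∀ {m n f g s} → Monic m f → Monic n g → s * f ≈ g →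
                     ∃ λ d → d ℕ.+ m ≡ n × Monic d s

    encode         : ∀ n → Carrier → Fin (q ℕ.^ n)
    encode-cong    : ∀ n {x y} → x ≈ y → encode n x ≡ encode n y
    residue        : ∀ n → Fin (q ℕ.^ n) → Carrier
    residue-low    : ∀ n i → Low n (residue n i)
    encode-residue : ∀ n i → encode n (residue n i) ≡ i
    residue-encode : ∀ {n x} → Low n x → residue n (encode n x) ≈ x
    monic          : ∀ n → Fin (q ℕ.^ n) → Carrier
    monic-monic    : ∀ n i → Monic n (monic n i)
    encode-monic   : ∀ n i → encode n (monic n i) ≡ i
    monic-encode   : ∀ {n x} → Monic n x → monic n (encode n x) ≈ x

-- Coefficient lists over a finite field satisfy the degree theory

module Polynomials {c ℓ q} (F : FiniteField c ℓ q) where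
  open FiniteField F
  open Polynomial commutativeRing
  open Congruences polyRing using (_∣_; _,_)

  private
    module P = CommutativeRing polyRing
    module Enum = Inverse cardinality

  _≈?_ : ∀ x y → Dec (x ≈ y)
  _≈?_ = Cardinality.≈-dec setoid cardinality

  1≉0 : 1# ≉ 0#
  1≉0 = proj₁ (proj₂ isField)

  inverse : ∀ x → x ≉ 0# → ∃ λ y → x * y ≈ 1#
  inverse = proj₂ (proj₂ isField)

  1<q : 1 ℕ.< q
  1<q = two-elements Enum.to Enum.from Enum.strictlyInverseʳ
    where
    two-elements : ∀ {m} (to : Carrier → Fin m) (from : Fin m → Carrier) → (∀ x → from (to x) ≈ x) → 1 ℕ.< m
    two-elements {zero}        to from h with () ← to 0#
    two-elements {suc zero}    to from h with to 0# | to 1# | h 0# | h 1#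
    ... | Fin.zero | Fin.zero | e | e′ = ⊥-elim (1≉0 (trans (sym e′) e))
    two-elements {suc (suc m)} to from h = s≤s (s≤s z≤n)

  ∷-cong : ∀ {x y p r} → x ≈ y → p ≈ₚ r → x ∷ p ≈ₚ y ∷ r
  ∷-cong e e′ = mk≈ₚ λ { zero → e ; (suc i) → coeff-≈ e′ i }

  Low : ℕ → Poly → Set ℓ
  Low n p = ∀ i → n ℕ.≤ i → coeff p i ≈ 0#

  Monic : ℕ → Poly → Set ℓ
  Monic = IsMonicOfDegree

  low-0 : ∀ p → Low 0 p → p ≈ₚ []
  low-0 p h = mk≈ₚ λ i → h i z≤n

  low-resp : ∀ {n} p r → p ≈ₚ r → Low n p → Low n r
  low-resp p r e h i n≤i = trans (sym (coeff-≈ e i)) (h i n≤i)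

  monic-resp : ∀ {n} p r → p ≈ₚ r → Monic n p → Monic n r
  monic-resp p r e (h , low) = trans (sym (coeff-≈ e _)) h , low-resp p r e low

  low-+ : ∀ {n} p r → Low n p → Low n r → Low n (p +ₚ r)
  low-+ p r h h′ i n≤i =
    trans (coeff-+ p r i) (trans (+-cong (h i n≤i) (h′ i n≤i)) (+-identityˡ 0#))

  low-neg : ∀ {n} p → Low n p → Low n (-ₚ p)
  low-neg p h i n≤i =
    trans (coeff-neg p i) (trans (-‿cong (h i n≤i)) (RingProperties.-0#≈0# ring))

  low-length : ∀ p → Low (length p) p
  low-length []      i       _         = refl
  low-length (x ∷ p) (suc i) (s≤s p≤i) = low-length p i p≤i

  low-∷ : ∀ {n x p} → Low n p → Low (suc n) (x ∷ p)
  low-∷ h (suc i) (s≤s n≤i) = h i n≤i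

  low-tail : ∀ {n} x p → Low (suc n) (x ∷ p) → Low n p
  low-tail x p h i n≤i = h (suc i) (s≤s n≤i)

  zero-* : ∀ p r → p ≈ₚ [] → p *ₚ r ≈ₚ []
  zero-* p r e = P.trans (P.*-congʳ {r} {p} {[]} e) (P.zeroˡ r)

  low-*-zero : ∀ p r → Low 0 p → ∀ i → coeff (0# ∷ (p *ₚ r)) i ≈ 0#
  low-*-zero p r h zero    = refl
  low-*-zero p r h (suc i) = coeff-≈ (zero-* p r (low-0 p h)) i

  -- One degree bound is strict and the other weak, so that the degree of the product is below a + b
  -- without predecessors.
  low-* : ∀ {a b} p r → Low a p → Low (suc b) r → Low (a ℕ.+ b) (p *ₚ r)
  low-* [] r h h′ i _ = refl
  low-* {zero} p r h h′ = low-resp [] (p *ₚ r)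
    (P.sym (zero-* p r (low-0 p h))) (λ _ _ → refl)
  low-* {suc a} {b} (x ∷ p) r h h′ (suc i) (s≤s ab≤i) = begin
    coeff ((x ∷ p) *ₚ r) (suc i)                   ≈⟨ coeff-+ (x ·ₚ r) _ (suc i) ⟩
    coeff (x ·ₚ r) (suc i) + coeff (p *ₚ r) i      ≈⟨ +-cong (coeff-· x r (suc i)) (low-* {a} p r (low-tail x p h) h′ i ab≤i) ⟩
    x * coeff r (suc i) + 0#                       ≈⟨ +-identityʳ _ ⟩
    x * coeff r (suc i)                            ≈⟨ *-congˡ (h′ (suc i) (s≤s (ℕ.≤-trans (ℕ.m≤n+m b a) ab≤i))) ⟩
    x * 0#                                         ≈⟨ zeroʳ x ⟩
    0#                                             ∎
    where open SetoidReasoning setoid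

  lead-* : ∀ {a b} p r → Low (suc a) p → Low (suc b) r →
           coeff (p *ₚ r) (a ℕ.+ b) ≈ coeff p a * coeff r b
  lead-* [] r h h′ = sym (zeroˡ _)
  lead-* {zero} {b} (x ∷ p) r h h′ = begin
    coeff ((x ∷ p) *ₚ r) b                             ≈⟨ coeff-+ (x ·ₚ r) _ b ⟩
    coeff (x ·ₚ r) b + coeff (0# ∷ (p *ₚ r)) b         ≈⟨ +-cong (coeff-· x r b) (low-*-zero p r (low-tail x p h) b) ⟩
    x * coeff r b + 0#                                 ≈⟨ +-identityʳ _ ⟩
    x * coeff r b                                      ∎
    where open SetoidReasoning setoid
  lead-* {suc a} {b} (x ∷ p) r h h′ = begin
    coeff ((x ∷ p) *ₚ r) (suc (a ℕ.+ b))                        ≈⟨ coeff-+ (x ·ₚ r) _ (suc (a ℕ.+ b)) ⟩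
    coeff (x ·ₚ r) (suc (a ℕ.+ b)) + coeff (p *ₚ r) (a ℕ.+ b)   ≈⟨ +-cong (coeff-· x r _) (lead-* {a} p r (low-tail x p h) h′) ⟩
    x * coeff r (suc (a ℕ.+ b)) + coeff p a * coeff r b         ≈⟨ +-congʳ (*-congˡ (h′ _ (s≤s (ℕ.m≤n+m b a)))) ⟩
    x * 0# + coeff p a * coeff r b                              ≈⟨ +-congʳ (zeroʳ x) ⟩
    0# + coeff p a * coeff r b                                  ≈⟨ +-identityˡ _ ⟩
    coeff p a * coeff r b                                       ∎
    where open SetoidReasoning setoid

  monic-* : ∀ {a b} p r → Monic a p → Monic b r → Monic (a ℕ.+ b) (p *ₚ r)
  monic-* p r (h , l) (h′ , l′) =
    trans (lead-* p r l l′) (trans (*-cong h h′) (*-identityˡ 1#)) , low-* p r l l′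

  monic-1 : Monic 0 P.1#
  monic-1 = refl , λ { (suc i) _ → refl }

  monic-0⇒1 : ∀ p → Monic 0 p → p ≈ₚ P.1#
  monic-0⇒1 p (h , l) = mk≈ₚ λ { zero → h ; (suc i) → l (suc i) (s≤s z≤n) }

  monic-+-low : ∀ {n} p r → Monic n p → Low n r → Monic n (p +ₚ r)
  monic-+-low {n} p r (h , l) l′ =
      trans (coeff-+ p r n) (trans (+-cong h (l′ n ℕ.≤-refl)) (+-identityʳ 1#))
    , λ i n<i → trans (coeff-+ p r i) (trans (+-cong (l i n<i) (l′ i (ℕ.<⇒≤ n<i))) (+-identityʳ 0#))

  monic-degree-unique : ∀ {a b} p → Monic a p → Monic b p → a ≡ b
  monic-degree-unique {a} {b} p (h , l) (h′ , l′) with ℕ.<-cmp a b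
  ... | tri< a<b _ _ = ⊥-elim (1≉0 (trans (sym h′) (l b a<b)))
  ... | tri≈ _ e _   = e
  ... | tri> _ _ b<a = ⊥-elim (1≉0 (trans (sym h) (l′ a b<a)))

  -- The length of a list only bounds its degree. The true degree is found by descending from the
  -- bound and testing coefficients against 0, which is decidable in a finite field.
  leading : ∀ n p → Low n p → p ≈ₚ [] ⊎ ∃ λ d → d ℕ.< n × coeff p d ≉ 0# × Low (suc d) p
  leading zero    p h = inj₁ (low-0 p h)
  leading (suc n) p h with coeff p n ≈? 0#
  ... | no ¬e = inj₂ (n , ℕ.≤-refl , ¬e , h)
  ... | yes e with leading n p h′
    where
    h′ : Low n p
    h′ i n≤i with ℕ.m≤n⇒m<n∨m≡n n≤i
    ... | inj₁ n<i    = h i n<i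
    ... | inj₂ ≡.refl = e
  ... | inj₁ z                  = inj₁ z
  ... | inj₂ (d , d<n , rest)   = inj₂ (d , ℕ.m≤n⇒m≤1+n d<n , rest)

  lead-*-monic : ∀ {a d} s f → Monic a f → Low (suc d) s → coeff (s *ₚ f) (d ℕ.+ a) ≈ coeff s d
  lead-*-monic s f (h , l) ls = trans (lead-* s f ls l) (trans (*-congˡ h) (*-identityʳ _))

  monic-∣-low : ∀ {a} f r → Monic a f → Low a r → f ∣ r → r ≈ₚ []
  monic-∣-low {a} f r m l (s , sf≈r) with leading (length s) s (low-length s)
  ... | inj₁ s≈0 = P.trans (P.sym sf≈r) (zero-* s f s≈0)
  ... | inj₂ (d , _ , ≉0 , ls) =
    ⊥-elim (≉0 (trans (sym (lead-*-monic s f m ls)) (trans (coeff-≈ sf≈r _) (l _ (ℕ.m≤n+m a d)))))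

  monic-*-zero : ∀ {a} f s → Monic a f → s *ₚ f ≈ₚ [] → s ≈ₚ []
  monic-*-zero f s m e with leading (length s) s (low-length s)
  ... | inj₁ s≈0 = s≈0
  ... | inj₂ (d , _ , ≉0 , ls) = ⊥-elim (≉0 (trans (sym (lead-*-monic s f m ls)) (coeff-≈ e _)))

  x-y≈0⇒x≈y : ∀ x y → x P.- y ≈ₚ [] → x ≈ₚ y
  x-y≈0⇒x≈y x y = GroupProperties.x∙y⁻¹≈ε⇒x≈y P.+-group x y

  x≈y⇒x-y≈0 : ∀ x y → x ≈ₚ y → x P.- y ≈ₚ []
  x≈y⇒x-y≈0 x y e = GroupProperties.x≈y⇒x∙y⁻¹≈ε P.+-group {x} {y} e

  monic-cancelʳ : ∀ {a} f x y → Monic a f → x *ₚ f ≈ₚ y *ₚ f → x ≈ₚ y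
  monic-cancelʳ f x y m e = x-y≈0⇒x≈y x y (monic-*-zero f (x P.- y) m
    (P.trans (RingProperties.[y-z]x≈yx-zx P.ring f x y) (x≈y⇒x-y≈0 (x *ₚ f) (y *ₚ f) e)))

  quotient-monic : ∀ {a b} f g s → Monic a f → Monic b g → s *ₚ f ≈ₚ g → ∃ λ e → e ℕ.+ a ≡ b × Monic e s
  quotient-monic {a} {b} f g s m (h , l) e with leading (length s) s (low-length s)
  ... | inj₁ s≈0 = ⊥-elim (1≉0 (trans (sym h) (trans (sym (coeff-≈ e b))
                     (coeff-≈ (zero-* s f s≈0) b))))
  ... | inj₂ (d , _ , ≉0 , ls) with ℕ.<-cmp (d ℕ.+ a) b
  ... | tri< lt _ _ = ⊥-elim (1≉0 (trans (sym h) (trans (sym (coeff-≈ e b)) (low-* s f ls (proj₂ m) b lt))))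
  ... | tri> _ _ gt = ⊥-elim (≉0 (trans (sym (lead-*-monic s f m ls)) (trans (coeff-≈ e _) (l _ gt))))
  ... | tri≈ _ ≡.refl _ = d , ≡.refl , trans (sym (lead-*-monic s f m ls)) (trans (coeff-≈ e _) h) , ls

  -- Horner's scheme: from p = s f + r follows x + t p = (t s + k) f + (x + t r - k f), and k, the
  -- coefficient of t ^ a in x + t r, is chosen to cancel that term.
  divide : ∀ {a} f → Monic a f → ∀ p → ∃₂ λ s r → Low a r × s *ₚ f +ₚ r ≈ₚ p
  divide {a} f (h , l) [] = [] , [] , (λ _ _ → refl) , P.refl
  divide {a} f m@(h , l) (x ∷ p) with divide f m p
  ... | s , r , lr , e = k ∷ s , (x ∷ r) P.- k ·ₚ f , low , (begin
    (k ·ₚ f +ₚ (0# ∷ (s *ₚ f))) +ₚ ((x ∷ r) P.- k ·ₚ f)   ≈⟨ P.+-comm (k ·ₚ f +ₚ (0# ∷ (s *ₚ f))) ((x ∷ r) P.- k ·ₚ f) ⟩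
    ((x ∷ r) P.- k ·ₚ f) +ₚ (k ·ₚ f +ₚ (0# ∷ (s *ₚ f)))   ≈⟨ P.+-assoc ((x ∷ r) P.- k ·ₚ f) (k ·ₚ f) (0# ∷ (s *ₚ f)) ⟨
    ((x ∷ r) P.- k ·ₚ f +ₚ k ·ₚ f) +ₚ (0# ∷ (s *ₚ f))     ≈⟨ P.+-congʳ {0# ∷ (s *ₚ f)} {(x ∷ r) P.- k ·ₚ f +ₚ k ·ₚ f} {x ∷ r} (GroupProperties.//-rightDividesˡ P.+-group (k ·ₚ f) (x ∷ r)) ⟩
    (x ∷ r) +ₚ (0# ∷ (s *ₚ f))                            ≈⟨ ∷-cong (+-identityʳ x) (P.trans (P.+-comm r (s *ₚ f)) e) ⟩
    x ∷ p                                                 ∎)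
    where
    open SetoidReasoning polySetoid
    k : Carrier
    k = coeff (x ∷ r) a
    low : Low a ((x ∷ r) P.- k ·ₚ f)
    low i a≤i = trans (coeff-+ (x ∷ r) (-ₚ (k ·ₚ f)) i)
      (trans (+-congˡ (trans (coeff-neg (k ·ₚ f) i) (-‿cong (coeff-· k f i)))) (zeros (ℕ.m≤n⇒m<n∨m≡n a≤i)))
      where
      zeros : a ℕ.< i ⊎ a ≡ i → coeff (x ∷ r) i - k * coeff f i ≈ 0#
      zeros (inj₁ a<i)    = trans (+-cong (low-∷ {p = r} lr i a<i) (-‿cong (trans (*-congˡ (l i a<i)) (zeroʳ k))))
                                  (-‿inverseʳ 0#)
      zeros (inj₂ ≡.refl) = trans (+-congˡ (-‿cong (trans (*-congˡ h) (*-identityʳ k)))) (-‿inverseʳ k)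

  _≈ₚ?_ : ∀ p r → Dec (p ≈ₚ r)
  p ≈ₚ? r with leading (length (p P.- r)) (p P.- r) (low-length (p P.- r))
  ... | inj₁ e                  = yes (x-y≈0⇒x≈y p r e)
  ... | inj₂ (d , _ , ≉0 , _)   = no λ e → ≉0 (coeff-≈ (x≈y⇒x-y≈0 p r e) d)

  fromCoeffs : ∀ n → (Fin n → Carrier) → Poly → Poly
  fromCoeffs zero    g t = t
  fromCoeffs (suc n) g t = g Fin.zero ∷ fromCoeffs n (g ∘ Fin.suc) t

  coeff-fromCoeffs-< : ∀ n g t j → coeff (fromCoeffs n g t) (toℕ j) ≡ g j
  coeff-fromCoeffs-< (suc n) g t Fin.zero    = ≡.refl
  coeff-fromCoeffs-< (suc n) g t (Fin.suc j) = coeff-fromCoeffs-< n (g ∘ Fin.suc) t j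

  coeff-fromCoeffs-≥ : ∀ n g t i → coeff (fromCoeffs n g t) (n ℕ.+ i) ≡ coeff t i
  coeff-fromCoeffs-≥ zero    g t i = ≡.refl
  coeff-fromCoeffs-≥ (suc n) g t i = coeff-fromCoeffs-≥ n (g ∘ Fin.suc) t i

  -- Only the coefficients below t ^ n are read, so one code serves for residues and for monic
  -- polynomials of degree n; `decode` appends the remaining part, `[]` or 1.
  encode : ∀ n → Poly → Fin (q ℕ.^ n)
  encode n p = funToFin {n} λ i → Enum.to (coeff p (toℕ i))

  decode : ∀ n → Poly → Fin (q ℕ.^ n) → Poly
  decode n t i = fromCoeffs n (λ j → Enum.from (finToFun i j)) t

  encode-cong : ∀ n p r → p ≈ₚ r → encode n p ≡ encode n r
  encode-cong n p r e = funToFin-cong {n} λ i → Enum.to-cong (coeff-≈ e (toℕ i))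

  encode-decode : ∀ n t i → encode n (decode n t i) ≡ i
  encode-decode n t i = ≡.trans
    (funToFin-cong λ j → ≡.trans
      (≡.cong Enum.to (coeff-fromCoeffs-< n (λ j → Enum.from (finToFun i j)) t j))
      (Enum.strictlyInverseˡ (finToFun i j)))
    (Fin.funToFin-finToFin {n} i)

  decode-encode : ∀ n t p → (∀ i → coeff t i ≈ coeff p (n ℕ.+ i)) → decode n t (encode n p) ≈ₚ p
  decode-encode n t p h = mk≈ₚ λ i → go i (i ℕ.<? n)
    where
    g : Fin n → Carrier
    g j = Enum.from (finToFun (encode n p) j)
    go : ∀ i → Dec (i ℕ.< n) → coeff (decode n t (encode n p)) i ≈ coeff p i
    go i (yes i<n) = ≡.subst (λ z → coeff (fromCoeffs n g t) z ≈ coeff p z) (Fin.toℕ-fromℕ< i<n)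
      (trans (reflexive (≡.trans (coeff-fromCoeffs-< n g t j)
               (≡.cong Enum.from (Fin.finToFun-funToFin (λ i → Enum.to (coeff p (toℕ i))) j))))
             (Enum.strictlyInverseʳ _))
      where
      j : Fin n
      j = fromℕ< i<n
    go i (no i≮n) = ≡.subst (λ z → coeff (fromCoeffs n g t) z ≈ coeff p z) (ℕ.m+[n∸m]≡n (ℕ.≮⇒≥ i≮n))
      (trans (reflexive (coeff-fromCoeffs-≥ n g t (i ℕ.∸ n))) (h (i ℕ.∸ n)))

  residue monic : ∀ n → Fin (q ℕ.^ n) → Poly
  residue n = decode n []
  monic   n = decode n P.1#

  residue-low : ∀ n i → Low n (residue n i)
  residue-low n i j n≤j = ≡.subst (λ z → coeff (residue n i) z ≈ 0#) (ℕ.m+[n∸m]≡n n≤j)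
    (reflexive (coeff-fromCoeffs-≥ n _ [] (j ℕ.∸ n)))

  monic-monic : ∀ n i → Monic n (monic n i)
  monic-monic n i =
      ≡.subst (λ z → coeff (monic n i) z ≈ 1#) (ℕ.+-identityʳ n)
        (reflexive (coeff-fromCoeffs-≥ n _ P.1# 0))
    , λ j n<j → ≡.subst (λ z → coeff (monic n i) z ≈ 0#) (ℕ.m+[n∸m]≡n (ℕ.<⇒≤ n<j))
        (trans (reflexive (coeff-fromCoeffs-≥ n _ P.1# (j ℕ.∸ n))) (proj₂ monic-1 _ (ℕ.m<n⇒0<n∸m n<j)))

  residue-encode : ∀ n p → Low n p → residue n (encode n p) ≈ₚ p
  residue-encode n p l = decode-encode n [] p λ i → sym (l (n ℕ.+ i) (ℕ.m≤m+n n i))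

  monic-encode : ∀ n p → Monic n p → monic n (encode n p) ≈ₚ p
  monic-encode n p (h , l) = decode-encode n P.1# p λ where
    zero    → sym (trans (reflexive (≡.cong (coeff p) (ℕ.+-identityʳ n))) h)
    (suc i) → sym (l (n ℕ.+ suc i) (ℕ.≤-trans (s≤s (ℕ.m≤m+n n i)) (ℕ.≤-reflexive (≡.sym (ℕ.+-suc n i)))))

  scale-monic : ∀ {d} u p → u * coeff p d ≈ 1# → Low (suc d) p → Monic d ((u ∷ []) *ₚ p)
  scale-monic {d} u p e l = trans (scaled d) e , λ i d<i → trans (scaled i) (trans (*-congˡ (l i d<i)) (zeroʳ u))
    where
    scaled : ∀ i → coeff ((u ∷ []) *ₚ p) i ≈ u * coeff p i
    scaled i = trans (coeff-+ (u ·ₚ p) (0# ∷ []) i)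
      (trans (+-cong (coeff-· u p i) (low-*-zero [] p (λ _ _ → refl) i)) (+-identityʳ _))

  normalise : ∀ {n} p → Low n p →
              p ≈ₚ [] ⊎ ∃ λ d → d ℕ.< n × ∃₂ λ u v → u *ₚ v ≈ₚ P.1# × Monic d (u *ₚ p)
  normalise {n} p l with leading n p l
  ... | inj₁ e                    = inj₁ e
  ... | inj₂ (d , d<n , ≉0 , low) =
    let (u , e) = inverse (coeff p d) ≉0 in
    inj₂ (d , d<n , u ∷ [] , coeff p d ∷ []
         , ∷-cong (trans (+-identityʳ _) (trans (*-comm u _) e)) P.refl
         , scale-monic u p (trans (*-comm u _) e) low)

  degreeTheory : DegreeTheory polyRing q
  degreeTheory = record
    { 1<q = 1<q
    ; _≈?_ = _≈ₚ?_
    ; Low = Low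
    ; Monic = Monic
    ; low-resp = λ {_} {x} {y} → low-resp x y
    ; 0-low = λ _ _ → refl
    ; low-+ = λ {_} {x} {y} → low-+ x y
    ; low-neg = λ {_} {x} → low-neg x
    ; monic-resp = λ {_} {x} {y} → monic-resp x y
    ; monic-1 = monic-1
    ; monic-0⇒1 = λ {x} → monic-0⇒1 x
    ; monic-* = λ {_} {_} {x} {y} → monic-* x y
    ; monic⇒low = λ {_} {_} {x} m<n (_ , l) i n≤i → l i (ℕ.≤-trans m<n n≤i)
    ; monic-+-low = λ {_} {x} {y} → monic-+-low x y
    ; monic-degree-unique = λ {_} {_} {x} → monic-degree-unique x
    ; normalise = λ {_} {x} → normalise x
    ; divide = λ {_} {f} → divide f
    ; monic-∣-low = λ {_} {f} {r} → monic-∣-low f r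
    ; monic-cancelʳ = λ {_} {f} {x} {y} → monic-cancelʳ f x y
    ; quotient-monic = λ {_} {_} {f} {g} {s} → quotient-monic f g s
    ; encode = encode
    ; encode-cong = λ n {x} {y} → encode-cong n x y
    ; residue = residue
    ; residue-low = residue-low
    ; encode-residue = λ n → encode-decode n []
    ; residue-encode = λ {n} {x} → residue-encode n x
    ; monic = monic
    ; monic-monic = monic-monic
    ; encode-monic = λ n → encode-decode n P.1#
    ; monic-encode = λ {n} {x} → monic-encode n x
    }

-- Prime elements and their number

module PrimeElements {c ℓ q} {R : CommutativeRing c ℓ} (T : DegreeTheory R q) where
  open CommutativeRing R
  open DegreeTheory T
  open Congruences R
  open RingProperties ring using (-‿distribʳ-*; -‿involutive)
  open CommutativeSemigroupProperties *-commutativeSemigroup using (x∙yz≈y∙xz; x∙yz≈yx∙z)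

  monic-∣-degree : ∀ {m n f g} → Monic m f → Monic n g → f ∣ g → m ℕ.≤ n
  monic-∣-degree {m} mf mg (s , e) with quotient-monic mf mg e
  ... | d , ≡.refl , _ = ℕ.m≤n+m m d

  monic-∣-≈ : ∀ {n f g} → Monic n f → Monic n g → f ∣ g → f ≈ g
  monic-∣-≈ {n} mf mg (s , e) with quotient-monic mf mg e
  ... | zero  , _  , ms = trans (sym (trans (*-congʳ (monic-0⇒1 ms)) (*-identityˡ _))) e
  ... | suc d , e′ , _  = ⊥-elim (ℕ.m≢1+n+m n (≡.sym e′))

  monic-^ : ∀ {d f} → Monic d f → ∀ k → Monic (k ℕ.* d) (f ^ k)
  monic-^ m zero    = monic-1
  monic-^ m (suc k) = monic-* m (monic-^ m k)

  module Remainder {n f} (m : Monic n f) where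

    rem : Carrier → Carrier
    rem x = proj₁ (proj₂ (divide m x))

    rem-low : ∀ x → Low n (rem x)
    rem-low x = proj₁ (proj₂ (proj₂ (divide m x)))

    rem-≡ : ∀ x → x ≡ rem x [mod f ]
    rem-≡ x = let (s , r , _ , e) = divide m x in
      s , trans (sym (GroupProperties.//-rightDividesʳ +-group r (s * f))) (+-congʳ e)

    rem-unique : ∀ {x r} → Low n r → x ≡ r [mod f ] → rem x ≈ r
    rem-unique {x} l e = GroupProperties.x∙y⁻¹≈ε⇒x≈y +-group _ _
      (monic-∣-low m (low-+ (rem-low x) (low-neg l)) (Mod.trans f (Mod.sym f (rem-≡ x)) e))

    divides? : ∀ x → Dec (f ∣ x)
    divides? x with rem x ≈? 0#
    ... | yes e = yes (≡0⇒∣ (Mod.trans f (rem-≡ x) (≈⇒≡ e)))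
    ... | no ¬e = no λ f∣x → ¬e (rem-unique 0-low (∣⇒≡0 f∣x))

  quotient-card : ∀ {n f} → Monic n f → Mod.setoid f HasCardinality (q ℕ.^ n)
  quotient-card {n} {f} m = record
    { to        = λ x → encode n (rem x)
    ; from      = residue n
    ; to-cong   = λ {x} {y} e → encode-cong n (rem-unique (rem-low y) (Mod.trans f e (rem-≡ y)))
    ; from-cong = λ { ≡.refl → Mod.refl f }
    ; inverse   = (λ {i} e → ≡.trans (encode-cong n (rem-unique (residue-low n i) e)) (encode-residue n i))
                , (λ { {x} ≡.refl → Mod.trans f (≈⇒≡ (residue-encode (rem-low x))) (Mod.sym f (rem-≡ x)) })
    }
    where open Remainder m

  Split : ℕ → Carrier → Set (c ⊔ ℓ)
  Split n f = ∃₂ λ a b → ∃₂ λ g h →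
    0 ℕ.< a × 0 ℕ.< b × a ℕ.+ b ≡ n × Monic a g × Monic b h × g * h ≈ f

  Unit : Carrier → Carrier → Set (c ⊔ ℓ)
  Unit f x = ∃ λ y → x * y ≡ 1# [mod f ]

  -- Euclid's algorithm on f and x: the last nonzero remainder is a unit or a proper factor of f.
  unit-or-split : ∀ {n f} → Monic n f → ∀ d {x} → d ℕ.< n → Monic d x → Unit f x ⊎ Split n f
  unit-or-split {n} {f} mf = <-rec _ step
    where
    step : ∀ d → (∀ {d′} → d′ ℕ.< d → ∀ {x} → d′ ℕ.< n → Monic d′ x → Unit f x ⊎ Split n f) →
           ∀ {x} → d ℕ.< n → Monic d x → Unit f x ⊎ Split n f
    step d rec {x} d<n mx with divide mx f
    ... | s , r , low , e with normalise low
    ... | inj₁ r≈0 = factor d d<n mx (quotient-monic mx mf s*x≈f)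
      where
      s*x≈f : s * x ≈ f
      s*x≈f = trans (sym (trans (+-congˡ r≈0) (+-identityʳ _))) e
      factor : ∀ d → d ℕ.< n → Monic d x → ∃ (λ b → b ℕ.+ d ≡ n × Monic b s) → Unit f x ⊎ Split n f
      factor zero    _   mx _                    = inj₁ (1# , ≈⇒≡ (trans (*-identityʳ x) (monic-0⇒1 mx)))
      factor (suc d) d<n mx (zero  , ≡.refl , _) = ⊥-elim (ℕ.<-irrefl ≡.refl d<n)
      factor (suc d) d<n mx (suc b , b+d≡n , ms) =
        inj₂ (suc b , suc d , s , x , s≤s z≤n , s≤s z≤n , b+d≡n , ms , mx , s*x≈f)
    ... | inj₂ (d′ , d′<d , u , _ , _ , mur) with rec d′<d (ℕ.<-trans d′<d d<n) mur
    ... | inj₂ split = inj₂ split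
    -- f = s x + r gives r ≡ x (- s), so an inverse of the normalised remainder u r is carried back
    -- to one of x.
    ... | inj₁ (y , ury≡1) = inj₁ (- s * (u * y) , (begin
      x * (- s * (u * y))    ≈⟨ ≈⇒≡ (sym (*-assoc x (- s) (u * y))) ⟩
      x * - s * (u * y)      ≈⟨ Mod.*-congʳ f x[-s]≡r ⟩
      r * (u * y)            ≈⟨ ≈⇒≡ (x∙yz≈yx∙z r u y) ⟩
      u * r * y              ≈⟨ ury≡1 ⟩
      1#                     ∎))
      where
      open SetoidReasoning (Mod.setoid f)
      x[-s]≡r : x * - s ≡ r [mod f ]
      x[-s]≡r = Mod.sym f (1# , trans (*-identityˡ f) (trans (sym e) (trans (+-comm _ r) (+-congˡ
        (trans (*-comm s x) (trans (sym (-‿involutive _)) (-‿cong (-‿distribʳ-* x s))))))))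

  -- `unit-or-split` is applied to all q ^ n residues. Either each nonzero one is invertible and the
  -- quotient is a field, or some run exhibits a factorisation; this decides primality and drives
  -- factorisation into primes.
  prime-or-split : ∀ {n f} → 0 ℕ.< n → Monic n f → PrimeModulus f ⊎ Split n f
  prime-or-split {n} {f} 0<n mf with all-or zero-or-unit
    where
    zero-or-unit : ∀ i → (residue n i ≈ 0# ⊎ Unit f (residue n i)) ⊎ Split n f
    zero-or-unit i with normalise (residue-low n i)
    ... | inj₁ z = inj₁ (inj₁ z)
    ... | inj₂ (d , d<n , u , _ , _ , mu) with unit-or-split mf d d<n mu
    ... | inj₂ split   = inj₂ split
    ... | inj₁ (y , e) = inj₁ (inj₂ (u * y , Mod.trans f (≈⇒≡ (x∙yz≈yx∙z _ u y)) e))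
  ... | inj₂ split = inj₂ split
  ... | inj₁ h     = inj₁ (Mod.*-comm f , 1≢0 , unit)
    where
    open Remainder mf
    1≢0 : ¬ 1# ≡ 0# [mod f ]
    1≢0 e = ℕ.<⇒≱ 0<n (monic-∣-degree mf monic-1 (≡0⇒∣ e))
    unit : ∀ x → ¬ x ≡ 0# [mod f ] → Unit f x
    unit x x≢0 with h (encode n (rem x)) | residue-encode (rem-low x)
    ... | inj₁ z       | e = ⊥-elim (x≢0 (Mod.trans f (rem-≡ x) (≈⇒≡ (trans (sym e) z))))
    ... | inj₂ (y , u) | e = y , Mod.trans f (Mod.*-congʳ f (Mod.trans f (rem-≡ x) (≈⇒≡ (sym e)))) u

  split⇒¬prime : ∀ {n f} → Monic n f → Split n f → ¬ PrimeModulus f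
  split⇒¬prime {n} {f} mf (a , b , g , h , 0<a , 0<b , ≡.refl , mg , mh , gh≈f) prime =
    ℕ.<⇒≱ (ℕ.m<n+m b 0<a) (monic-∣-degree mf mh (euclid prime f∤g (1# , trans (*-identityˡ f) (sym gh≈f))))
    where
    f∤g : f ∤ g
    f∤g = ℕ.<⇒≱ (ℕ.m<m+n a 0<b) ∘ monic-∣-degree mf mg

  prime-degree>0 : ∀ {n f} → Monic n f → PrimeModulus f → 0 ℕ.< n
  prime-degree>0 {zero} {f} mf (_ , 1≢0 , _) =
    ⊥-elim (1≢0 (∣⇒≡0 (1# , trans (*-identityˡ f) (monic-0⇒1 mf))))
  prime-degree>0 {suc n} mf _ = s≤s z≤n

  prime? : ∀ {n f} → Monic n f → Dec (PrimeModulus f)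
  prime? {zero}  mf = no λ prime → ℕ.<-irrefl ≡.refl (prime-degree>0 mf prime)
  prime? {suc n} mf with prime-or-split (s≤s z≤n) mf
  ... | inj₁ prime = yes prime
  ... | inj₂ split = no (split⇒¬prime mf split)

  PrimeFactor : ℕ → Carrier → Set (c ⊔ ℓ)
  PrimeFactor n f = ∃₂ λ d e → ∃₂ λ P s →
    PrimeModulus P × d ℕ.+ e ≡ n × Monic d P × Monic e s × P * s ≈ f

  prime-factor : ∀ n {f} → 0 ℕ.< n → Monic n f → PrimeFactor n f
  prime-factor = <-rec _ step
    where
    step : ∀ n → (∀ {n′} → n′ ℕ.< n → ∀ {f} → 0 ℕ.< n′ → Monic n′ f → PrimeFactor n′ f) →
           ∀ {f} → 0 ℕ.< n → Monic n f → PrimeFactor n f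
    step n rec {f} 0<n mf with prime-or-split 0<n mf
    ... | inj₁ prime = n , 0 , f , 1# , prime , ℕ.+-identityʳ n , mf , monic-1 , *-identityʳ f
    ... | inj₂ (a , b , g , h , 0<a , 0<b , ≡.refl , mg , mh , gh≈f)
      with rec (ℕ.m<m+n a 0<b) 0<a mg
    ... | d , e , P , s , prime , ≡.refl , mP , ms , Ps≈g =
      d , e ℕ.+ b , P , s * h , prime , ≡.sym (ℕ.+-assoc d e b) , mP , monic-* ms mh ,
      trans (sym (*-assoc P s h)) (trans (*-congʳ Ps≈g) gh≈f)

  prime-∣-prime : ∀ {m n P Q} → Monic m P → Monic n Q → PrimeModulus P → PrimeModulus Q → P ∣ Q → P ≈ Q
  prime-∣-prime mP mQ primeP primeQ (s , sP≈Q) with quotient-monic mP mQ sP≈Q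
  ... | zero  , ≡.refl , _  = monic-∣-≈ mP mQ (s , sP≈Q)
  ... | suc d , e      , ms = ⊥-elim (split⇒¬prime mQ
    (suc d , _ , s , _ , s≤s z≤n , prime-degree>0 mP primeP , e , ms , mP , sP≈Q) primeQ)

  -- Multiplicities of primes and the degree identity

  power-divides? : ∀ {d P} → Monic d P → ∀ k x → Dec (P ^ k ∣ x)
  power-divides? mP k = Remainder.divides? (monic-^ mP k)

  -- The exponent of P in x, cut off at M. As a sum over powers of P, it can be summed over x first,
  -- where each power contributes a count of multiples.
  multiplicity : ∀ {d P} → Monic d P → ℕ → Carrier → ℕ
  multiplicity mP M x = sum {M} λ k → ⟦ power-divides? mP (suc (toℕ k)) x ⟧

  multiplicity-cong : ∀ {d P x y} (mP : Monic d P) M → x ≈ y → multiplicity mP M x ≡ multiplicity mP M y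
  multiplicity-cong mP M e = sum-cong-≗ {M} λ k →
    ⟦⟧-cong (power-divides? mP (suc (toℕ k)) _) (power-divides? mP (suc (toℕ k)) _)
            (∣-respʳ e) (∣-respʳ (sym e))

  -- Euclid's lemma moves one factor P at a time from p * s into s; it is then cancelled from both
  -- sides.
  power-∣-cancel : ∀ {d P p s} → Monic d P → PrimeModulus P → P ∤ p → ∀ k → P ^ k ∣ p * s → P ^ k ∣ s
  power-∣-cancel {s = s} mP prime P∤p zero    _   = s , *-identityʳ s
  power-∣-cancel {P = P} {p} {s} mP prime P∤p (suc k) (t , e)
    with euclid prime P∤p (t * P ^ k , trans (*-assoc t _ P) (trans (*-congˡ (*-comm _ P)) e))
  ... | s′ , s′P≈s = ∣-respˡ (*-comm (P ^ k) P) (∣-respʳ s′P≈s (*-monoʳ-∣ P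
          (power-∣-cancel mP prime P∤p k (t , monic-cancelʳ mP (begin
            t * P ^ k * P     ≈⟨ *-assoc t _ P ⟩
            t * (P ^ k * P)   ≈⟨ *-congˡ (*-comm _ P) ⟩
            t * (P * P ^ k)   ≈⟨ e ⟩
            p * s             ≈⟨ *-congˡ s′P≈s ⟨
            p * (s′ * P)      ≈⟨ *-assoc p s′ P ⟨
            p * s′ * P        ∎)))))
    where open SetoidReasoning setoid

  multiplicity-other : ∀ {d P p s} (mP : Monic d P) M → PrimeModulus P → P ∤ p →
                       multiplicity mP M (p * s) ≡ multiplicity mP M s
  multiplicity-other {p = p} mP M prime P∤p = sum-cong-≗ {M} λ k →
    ⟦⟧-cong (power-divides? mP (suc (toℕ k)) _) (power-divides? mP (suc (toℕ k)) _)
            (power-∣-cancel mP prime P∤p (suc (toℕ k))) (∣-* p)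

  power-∤-small : ∀ {d n P s} → Monic d P → 0 ℕ.< d → Monic n s → ∀ k → n ℕ.< k → P ^ k ∤ s
  power-∤-small {suc d} mP _ ms k n<k P^k∣s =
    ℕ.<⇒≱ n<k (ℕ.≤-trans (ℕ.m≤m*n k (suc d)) (monic-∣-degree (monic-^ mP k) ms P^k∣s))

  multiplicity-1 : ∀ {d P x} (mP : Monic d P) M → 0 ℕ.< d → Monic 0 x → multiplicity mP M x ≡ 0
  multiplicity-1 mP M 0<d mx = sum-zero {M} _ λ k →
    ⟦⟧-no (power-divides? mP (suc (toℕ k)) _) (power-∤-small mP 0<d mx (suc (toℕ k)) (s≤s z≤n))

  -- Multiplying s by P shifts the sequence of indicators by one place: a 1 enters in front, and the
  -- indicator lost at the end is 0 because P ^ M has degree above that of s.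
  multiplicity-same : ∀ {d n P s} (mP : Monic d P) M → 0 ℕ.< d → Monic n s → n ℕ.< M →
                      multiplicity mP M (P * s) ≡ suc (multiplicity mP M s)
  multiplicity-same {P = P} {s} mP (suc M) 0<d ms (s≤s n≤M) = begin
    ⟦ power-divides? mP 1 (P * s) ⟧ ℕ.+ sum {M} (λ k → ⟦ power-divides? mP (2 ℕ.+ toℕ k) (P * s) ⟧)
      ≡⟨ ≡.cong₂ ℕ._+_ (⟦⟧-yes (power-divides? mP 1 (P * s)) P∣Ps) (sum-cong-≗ {M} (shift ∘ toℕ)) ⟩
    suc (sum {M} (λ k → ⟦ power-divides? mP (suc (toℕ k)) s ⟧))
      ≡⟨ ≡.cong suc (ℕ.+-identityʳ _) ⟨
    suc (sum {M} (λ k → ⟦ power-divides? mP (suc (toℕ k)) s ⟧) ℕ.+ 0)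
      ≡⟨ ≡.cong (λ z → suc (sum {M} (λ k → ⟦ power-divides? mP (suc (toℕ k)) s ⟧) ℕ.+ z))
           (⟦⟧-no (power-divides? mP (suc M) s) (power-∤-small mP 0<d ms (suc M) (s≤s n≤M))) ⟨
    suc (sum {M} (λ k → ⟦ power-divides? mP (suc (toℕ k)) s ⟧) ℕ.+ ⟦ power-divides? mP (suc M) s ⟧)
      ≡⟨ ≡.cong suc (sum-suc M (λ k → ⟦ power-divides? mP (suc k) s ⟧)) ⟨
    suc (multiplicity mP (suc M) s) ∎
    where
    open ≡.≡-Reasoning
    P∣Ps : P ^ 1 ∣ P * s
    P∣Ps = s , trans (*-congˡ (*-identityʳ P)) (*-comm s P)
    cancel : ∀ {k} → P * P ^ k ∣ P * s → P ^ k ∣ s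
    cancel {k} (t , e) = t , monic-cancelʳ mP
      (trans (*-assoc t _ P) (trans (*-congˡ (*-comm _ P)) (trans e (*-comm P s))))
    shift : ∀ k → ⟦ power-divides? mP (2 ℕ.+ k) (P * s) ⟧ ≡ ⟦ power-divides? mP (suc k) s ⟧
    shift k = ⟦⟧-cong (power-divides? mP (2 ℕ.+ k) (P * s)) (power-divides? mP (suc k) s)
      (cancel {suc k})
      (λ { (t , e) → t , trans (x∙yz≈y∙xz t P (P ^ suc k)) (*-congˡ e) })

  primeAt? : ∀ d j → Dec (PrimeModulus (monic d j))
  primeAt? d j = prime? (monic-monic d j)

  -- Σ_P deg P · v_P(x) over the primes of degree at most M, with the degree shifted by one in the
  -- index.
  totalDegree : ℕ → Carrier → ℕ
  totalDegree M x = sum {M} λ d → sum λ j →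
    ⟦ primeAt? (suc (toℕ d)) j ⟧ ℕ.* (suc (toℕ d) ℕ.* multiplicity (monic-monic (suc (toℕ d)) j) M x)

  totalDegree-cong : ∀ M {x y} → x ≈ y → totalDegree M x ≡ totalDegree M y
  totalDegree-cong M e = sum-cong-≗ {M} λ d → sum-cong-≗ λ j →
    ≡.cong (λ z → ⟦ primeAt? (suc (toℕ d)) j ⟧ ℕ.* (suc (toℕ d) ℕ.* z))
           (multiplicity-cong (monic-monic (suc (toℕ d)) j) M e)

  -- P is hit by a single pair of indices: its degree fixes the outer one, its code the inner one.
  weight-of-prime : ∀ {d P} M → d ℕ.≤ M → Monic d P → PrimeModulus P →
    sum {M} (λ d → sum λ j → ⟦ primeAt? (suc (toℕ d)) j ⟧ ℕ.* (suc (toℕ d) ℕ.* ⟦ monic (suc (toℕ d)) j ≈? P ⟧)) ≡ d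
  weight-of-prime {zero}  M _ mP prime = ⊥-elim (ℕ.<-irrefl ≡.refl (prime-degree>0 mP prime))
  weight-of-prime {suc d} {P} M d<M mP prime = begin
    sum {M} (λ e → S (toℕ e))   ≡⟨ sum-single {M} (λ e → S (toℕ e)) (fromℕ< d<M) (λ e e≢ → other (toℕ e) (λ e≡d →
                                      e≢ (Fin.toℕ-injective (≡.trans e≡d (≡.sym (Fin.toℕ-fromℕ< d<M)))))) ⟩
    S (toℕ (fromℕ< d<M))        ≡⟨ ≡.cong S (Fin.toℕ-fromℕ< d<M) ⟩
    S d                         ≡⟨ sum-single (term d) (encode (suc d) P) (λ j j≢ → term-no d j (λ e →
                                      j≢ (≡.trans (≡.sym (encode-monic (suc d) j)) (encode-cong (suc d) e)))) ⟩
    term d (encode (suc d) P)   ≡⟨ ≡.cong₂ (λ u v → u ℕ.* (suc d ℕ.* v))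
                                      (⟦⟧-yes (primeAt? (suc d) _) (prime-resp (∣-reflexive (sym here)) (∣-reflexive here) prime))
                                      (⟦⟧-yes (monic (suc d) _ ≈? P) here) ⟩
    1 ℕ.* (suc d ℕ.* 1)         ≡⟨ ≡.trans (ℕ.*-identityˡ (suc d ℕ.* 1)) (ℕ.*-identityʳ (suc d)) ⟩
    suc d                       ∎
    where
    open ≡.≡-Reasoning
    ∣-reflexive : ∀ {x y} → x ≈ y → x ∣ y
    ∣-reflexive {x} e = 1# , trans (*-identityˡ x) e
    here : monic (suc d) (encode (suc d) P) ≈ P
    here = monic-encode mP
    term : ∀ e → Fin (q ℕ.^ suc e) → ℕ
    term e j = ⟦ primeAt? (suc e) j ⟧ ℕ.* (suc e ℕ.* ⟦ monic (suc e) j ≈? P ⟧)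
    S : ℕ → ℕ
    S e = sum (term e)
    term-no : ∀ e j → ¬ monic (suc e) j ≈ P → term e j ≡ 0
    term-no e j ¬e = ≡.trans
      (≡.cong (λ v → ⟦ primeAt? (suc e) j ⟧ ℕ.* (suc e ℕ.* v)) (⟦⟧-no (monic (suc e) j ≈? P) ¬e))
      (≡.trans (≡.cong (⟦ primeAt? (suc e) j ⟧ ℕ.*_) (ℕ.*-zeroʳ (suc e))) (ℕ.*-zeroʳ ⟦ primeAt? (suc e) j ⟧))
    other : ∀ e → e ≢ d → S e ≡ 0
    other e e≢d = sum-zero (term e) λ j → term-no e j λ eq →
      e≢d (ℕ.suc-injective (monic-degree-unique (monic-resp eq (monic-monic (suc e) j)) mP))

  multiplicity-prime-* : ∀ {d e n P Q s} (mQ : Monic e Q) M → Monic d P → PrimeModulus P → PrimeModulus Q →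
    Monic n s → n ℕ.< M → multiplicity mQ M (P * s) ≡ ⟦ Q ≈? P ⟧ ℕ.+ multiplicity mQ M s
  multiplicity-prime-* {P = P} {Q} {s} mQ M mP primeP primeQ ms n<M with Q ≈? P
  ... | yes Q≈P = ≡.trans (multiplicity-cong mQ M (*-congʳ (sym Q≈P)))
                          (multiplicity-same mQ M (prime-degree>0 mQ primeQ) ms n<M)
  ... | no Q≉P  = multiplicity-other mQ M primeQ (Q≉P ∘ prime-∣-prime mQ mP primeQ primeP)

  -- Unique factorisation in the form used by the count. Splitting off a prime P raises the
  -- multiplicity of P by one and leaves the others unchanged, so both sides drop by deg P.
  totalDegree-monic : ∀ M n {x} → n ℕ.≤ M → Monic n x → totalDegree M x ≡ n
  totalDegree-monic M = <-rec _ step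
    where
    step : ∀ n → (∀ {n′} → n′ ℕ.< n → ∀ {x} → n′ ℕ.≤ M → Monic n′ x → totalDegree M x ≡ n′) →
           ∀ {x} → n ℕ.≤ M → Monic n x → totalDegree M x ≡ n
    step zero rec {x} _ mx = sum-zero {M} _ λ d → sum-zero _ λ j → ≡.trans
      (≡.cong (λ z → ⟦ primeAt? (suc (toℕ d)) j ⟧ ℕ.* (suc (toℕ d) ℕ.* z))
              (multiplicity-1 (monic-monic (suc (toℕ d)) j) M (s≤s z≤n) mx))
      (≡.trans (≡.cong (⟦ primeAt? (suc (toℕ d)) j ⟧ ℕ.*_) (ℕ.*-zeroʳ (suc (toℕ d)))) (ℕ.*-zeroʳ ⟦ primeAt? (suc (toℕ d)) j ⟧))
    step (suc n) rec {x} n<M mx with prime-factor (suc n) (s≤s z≤n) mx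
    ... | d , e , P , s , prime , d+e≡n , mP , ms , Ps≈x = begin
      totalDegree M x                          ≡⟨ totalDegree-cong M Ps≈x ⟨
      totalDegree M (P * s)                    ≡⟨ sum-cong-≗ {M} (λ d → sum-cong-≗ (split-term (toℕ d))) ⟩
      sum {M} (λ d → sum λ j → A (toℕ d) j ℕ.+ B (toℕ d) j)
                                               ≡⟨ sum-cong-≗ {M} (λ d → ∑-distrib-+ (A (toℕ d)) (B (toℕ d))) ⟩
      sum {M} (λ d → sum (A (toℕ d)) ℕ.+ sum (B (toℕ d)))
                                               ≡⟨ ∑-distrib-+ {M} (λ d → sum (A (toℕ d))) (λ d → sum (B (toℕ d))) ⟩
      sum {M} (λ d → sum (A (toℕ d))) ℕ.+ totalDegree M s
                                               ≡⟨ ≡.cong₂ ℕ._+_ (weight-of-prime M d≤M mP prime) (rec e<n (ℕ.<⇒≤ e<M) ms) ⟩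
      d ℕ.+ e                                  ≡⟨ d+e≡n ⟩
      suc n                                    ∎
      where
      open ≡.≡-Reasoning
      e<n : e ℕ.< suc n
      e<n = ≡.subst (e ℕ.<_) d+e≡n (ℕ.m<n+m e (prime-degree>0 mP prime))
      e<M : e ℕ.< M
      e<M = ℕ.<-≤-trans e<n n<M
      d≤M : d ℕ.≤ M
      d≤M = ℕ.≤-trans (≡.subst (d ℕ.≤_) d+e≡n (ℕ.m≤m+n d e)) n<M
      A B : ∀ d → Fin (q ℕ.^ suc d) → ℕ
      A d j = ⟦ primeAt? (suc d) j ⟧ ℕ.* (suc d ℕ.* ⟦ monic (suc d) j ≈? P ⟧)
      B d j = ⟦ primeAt? (suc d) j ⟧ ℕ.* (suc d ℕ.* multiplicity (monic-monic (suc d) j) M s)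
      split-term : ∀ d j → ⟦ primeAt? (suc d) j ⟧ ℕ.* (suc d ℕ.* multiplicity (monic-monic (suc d) j) M (P * s))
                         ≡ A d j ℕ.+ B d j
      split-term d j with primeAt? (suc d) j
      ... | no _       = ≡.refl
      ... | yes primeQ = ≡.trans
        (≡.cong (λ z → 1 ℕ.* (suc d ℕ.* z)) (multiplicity-prime-* (monic-monic (suc d) j) M mP prime primeQ ms e<M))
        (expand (suc d) ⟦ monic (suc d) j ≈? P ⟧ (multiplicity (monic-monic (suc d) j) M s))
        where
        expand : ∀ d u v → 1 ℕ.* (d ℕ.* (u ℕ.+ v)) ≡ 1 ℕ.* (d ℕ.* u) ℕ.+ 1 ℕ.* (d ℕ.* v)
        expand = solve-∀

  count-multiples : ∀ {e g} (mg : Monic e g) m →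
                    sum (λ i → ⟦ Remainder.divides? mg (monic m i) ⟧) ≡ multiples q m e
  count-multiples {e} {g} mg m with e ℕ.≤? m
  ... | no e≰m  = ≡.trans (sum-zero _ λ i → ⟦⟧-no (Remainder.divides? mg (monic m i))
                             (e≰m ∘ monic-∣-degree mg (monic-monic m i)))
                          (≡.sym (multiples-> q m e (ℕ.≰⇒> e≰m)))
  ... | yes e≤m = ≡.trans
    (sum-indicator-image (λ i → Remainder.divides? mg (monic m i)) φ φ-injective sound complete)
    (≡.sym (multiples-≤ q m e e≤m))
    where
    a : ℕ
    a = m ℕ.∸ e
    product-monic : ∀ {h} → Monic a h → Monic m (h * g)
    product-monic mh = ≡.subst (λ z → Monic z _) (ℕ.m∸n+n≡m e≤m) (monic-* mh mg)
    φ : Fin (q ℕ.^ a) → Fin (q ℕ.^ m)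
    φ k = encode m (monic a k * g)
    decode-φ : ∀ k → monic m (φ k) ≈ monic a k * g
    decode-φ k = monic-encode (product-monic (monic-monic a k))
    φ-injective : ∀ {i j} → φ i ≡ φ j → i ≡ j
    φ-injective {i} {j} eq = ≡.trans (≡.sym (encode-monic a i)) (≡.trans
      (encode-cong a (monic-cancelʳ mg (trans (sym (decode-φ i)) (trans (reflexive (≡.cong (monic m) eq)) (decode-φ j)))))
      (encode-monic a j))
    sound : ∀ k → g ∣ monic m (φ k)
    sound k = monic a k , sym (decode-φ k)
    complete : ∀ i → g ∣ monic m i → ∃ λ k → φ k ≡ i
    complete i (h , hg≈) with quotient-monic mg (monic-monic m i) hg≈
    ... | d , d+e≡m , mh = encode a h , ≡.trans
      (encode-cong m (trans (*-congʳ (monic-encode (≡.subst (λ z → Monic z h) d≡a mh))) hg≈))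
      (encode-monic m i)
      where
      d≡a : d ≡ a
      d≡a = ≡.trans (≡.sym (ℕ.m+n∸n≡m d e)) (≡.cong (ℕ._∸ e) d+e≡m)

  primeCount : ℕ → ℕ
  primeCount d = sum λ j → ⟦ primeAt? d j ⟧

  degree-sum : ∀ M m → m ℕ.≤ M →
    sum {M} (λ d → primeCount (suc (toℕ d)) ℕ.* suc (toℕ d) ℕ.*
                   sum {M} (λ k → multiples q m (suc (toℕ k) ℕ.* suc (toℕ d)))) ≡ m ℕ.* q ℕ.^ m
  degree-sum M m m≤M = begin
    sum {M} (λ d → primeCount (suc (toℕ d)) ℕ.* suc (toℕ d) ℕ.* X (toℕ d))
      ≡⟨ sum-cong-≗ {M} (λ d → column (toℕ d)) ⟨
    sum {M} (λ d → sum {q ℕ.^ m} λ i → sum λ j → t (toℕ d) j i)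
      ≡⟨ ∑-comm {M} (λ d i → sum λ j → t (toℕ d) j i) ⟩
    sum {q ℕ.^ m} (λ i → totalDegree M (monic m i))
      ≡⟨ sum-const (λ i → totalDegree M (monic m i)) m (λ i → totalDegree-monic M m m≤M (monic-monic m i)) ⟩
    q ℕ.^ m ℕ.* m
      ≡⟨ ℕ.*-comm (q ℕ.^ m) m ⟩
    m ℕ.* q ℕ.^ m ∎
    where
    open ≡.≡-Reasoning
    X : ℕ → ℕ
    X d = sum {M} (λ k → multiples q m (suc (toℕ k) ℕ.* suc d))
    t : ∀ d → Fin (q ℕ.^ suc d) → Fin (q ℕ.^ m) → ℕ
    t d j i = ⟦ primeAt? (suc d) j ⟧ ℕ.* (suc d ℕ.* multiplicity (monic-monic (suc d) j) M (monic m i))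
    multiplicities : ∀ d j → sum (λ i → multiplicity (monic-monic (suc d) j) M (monic m i)) ≡ X d
    multiplicities d j = begin
      sum (λ i → sum {M} λ k → ⟦ power-divides? (monic-monic (suc d) j) (suc (toℕ k)) (monic m i) ⟧)
        ≡⟨ ∑-comm {n = M} (λ i k → ⟦ power-divides? (monic-monic (suc d) j) (suc (toℕ k)) (monic m i) ⟧) ⟩
      sum {M} (λ k → sum λ i → ⟦ power-divides? (monic-monic (suc d) j) (suc (toℕ k)) (monic m i) ⟧)
        ≡⟨ sum-cong-≗ {M} (λ k → count-multiples (monic-^ (monic-monic (suc d) j) (suc (toℕ k))) m) ⟩
      X d ∎
    row : ∀ d j → sum (t d j) ≡ ⟦ primeAt? (suc d) j ⟧ ℕ.* (suc d ℕ.* X d)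
    row d j = begin
      sum (λ i → ι ℕ.* (suc d ℕ.* μ i))     ≡⟨ *-distribˡ-sum ι (λ i → suc d ℕ.* μ i) ⟨
      ι ℕ.* sum (λ i → suc d ℕ.* μ i)       ≡⟨ ≡.cong (ι ℕ.*_) (*-distribˡ-sum (suc d) μ) ⟨
      ι ℕ.* (suc d ℕ.* sum μ)               ≡⟨ ≡.cong (λ z → ι ℕ.* (suc d ℕ.* z)) (multiplicities d j) ⟩
      ι ℕ.* (suc d ℕ.* X d)                 ∎
      where
      ι : ℕ
      ι = ⟦ primeAt? (suc d) j ⟧
      μ : Fin (q ℕ.^ m) → ℕ
      μ i = multiplicity (monic-monic (suc d) j) M (monic m i)
    column : ∀ d → sum {q ℕ.^ m} (λ i → sum λ j → t d j i) ≡ primeCount (suc d) ℕ.* suc d ℕ.* X d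
    column d = begin
      sum {q ℕ.^ m} (λ i → sum λ j → t d j i)                       ≡⟨ ∑-comm {q ℕ.^ m} (λ i j → t d j i) ⟩
      sum (λ j → sum (t d j))                                       ≡⟨ sum-cong-≗ (row d) ⟩
      sum (λ j → ⟦ primeAt? (suc d) j ⟧ ℕ.* (suc d ℕ.* X d))        ≡⟨ *-distribʳ-sum (suc d ℕ.* X d) (λ j → ⟦ primeAt? (suc d) j ⟧) ⟨
      primeCount (suc d) ℕ.* (suc d ℕ.* X d)                        ≡⟨ ℕ.*-assoc (primeCount (suc d)) (suc d) (X d) ⟨
      primeCount (suc d) ℕ.* suc d ℕ.* X d                          ∎

  primeCount-bound : ∀ m h → suc m ℕ.< suc h ℕ.+ suc h → h ℕ.≤ m →
                     q ℕ.^ suc m ℕ.+ 2 ℕ.≤ primeCount (suc m) ℕ.* suc m ℕ.+ 2 ℕ.* q ℕ.^ h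
  primeCount-bound m h m<2h h≤m =
    Gauss.lower-bound q 1<q (suc m) (λ d → primeCount (suc d) ℕ.* suc d) (degree-sum (suc m)) m h ≡.refl m<2h h≤m

-- Carmichael elements

module Enumeration {a ℓ p} (S : Setoid a ℓ) (P : Pred (Setoid.Carrier S) p) where
  open Setoid S

  subsetoid : Setoid (a ⊔ p) ℓ
  subsetoid = record
    { Carrier       = Σ Carrier P
    ; _≈_           = _≈_ on proj₁
    ; isEquivalence = On.isEquivalence proj₁ isEquivalence
    }

  Distinct : List Carrier → Set (a ⊔ ℓ)
  Distinct = AllPairs _≉_

  lookup-injective : ∀ {xs} → Distinct xs → ∀ i j → lookup xs i ≈ lookup xs j → i ≡ j
  lookup-injective (x∉ ∷ _) Fin.zero    Fin.zero    _ = ≡.refl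
  lookup-injective (x∉ ∷ _) Fin.zero    (Fin.suc j) e = ⊥-elim (All.lookup x∉ (∈-lookup j) e)
  lookup-injective d@(_ ∷ _) (Fin.suc i) Fin.zero e = ≡.sym (lookup-injective d Fin.zero (Fin.suc i) (sym e))
  lookup-injective (_ ∷ d) (Fin.suc i) (Fin.suc j) e = ≡.cong Fin.suc (lookup-injective d i j e)

  lookup-All : ∀ {xs} → All P xs → ∀ i → P (lookup xs i)
  lookup-All ps i = All.lookup ps (∈-lookup i)

  module _ {xs : List Carrier} (complete : ∀ x → P x → Any (x ≈_) xs) where

    private
      index : Σ Carrier P → Fin (length xs)
      index (x , p) = Any.index (complete x p)

      lookup-index : ∀ x → lookup xs (index x) ≈ proj₁ x
      lookup-index (x , p) = sym (Any.lookup-index (complete x p))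

    length≤ : ∀ {ys} → All P ys → Distinct ys → length ys ℕ.≤ length xs
    length≤ {ys} ps d = Fin.injective⇒≤ {f = λ i → index (lookup ys i , lookup-All ps i)} λ {i} {j} e →
      lookup-injective d i j (trans (sym (lookup-index _))
        (trans (reflexive (≡.cong (lookup xs) e)) (lookup-index _)))

    enumeration : All P xs → Distinct xs → subsetoid HasCardinality length xs
    enumeration ps d = record
      { to        = index
      ; from      = λ i → lookup xs i , lookup-All ps i
      ; to-cong   = λ {x} {y} e → lookup-injective d _ _
                      (trans (lookup-index x) (trans e (sym (lookup-index y))))
      ; from-cong = λ { ≡.refl → refl }
      ; inverse   = (λ {i} {x} e → lookup-injective d _ i (trans (lookup-index x) e))
                  , (λ { {x} ≡.refl → lookup-index x })
      }

length-filter-tabulate : ∀ {a p n} {A : Set a} {P : Pred A p} (P? : Decidable P) (f : Fin n → A) →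
  length (filter P? (tabulate f)) ≡ sum (λ i → ⟦ P? (f i) ⟧)
length-filter-tabulate {n = zero}  P? f = ≡.refl
length-filter-tabulate {n = suc n} P? f with P? (f Fin.zero)
... | yes _ = ≡.cong suc (length-filter-tabulate P? (f ∘ Fin.suc))
... | no  _ = length-filter-tabulate P? (f ∘ Fin.suc)

module CarmichaelElements {c ℓ q} {R : CommutativeRing c ℓ} (T : DegreeTheory R q) where
  open CommutativeRing R
  open DegreeTheory T
  open Congruences R
  open PrimeElements T

  Carmichael : Carrier → Set (c ⊔ ℓ)
  Carmichael f = IsCarmichaelRing (Mod.ring f)

  -- The exponent in the definition is some cardinality of the quotient; uniqueness of cardinalities
  -- identifies it with q ^ n.
  carmichael⇒ : ∀ {n f} → Monic n f → Carmichael f → ¬ PrimeModulus f × Fixes (q ℕ.^ n) f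
  carmichael⇒ {n} {f} mf (m , card , ¬prime , fix) = ¬prime , λ a →
    ≡.subst (λ z → z ≡ a [mod f ]) (Mod-^ f a (q ℕ.^ n))
      (≡.subst (λ k → SemiringExp._^_ (Mod.semiring f) a k ≡ a [mod f ])
        (Cardinality.card-unique (Mod.setoid f) card (quotient-card mf)) (fix a))

  carmichael⇐ : ∀ {n f} → Monic n f → ¬ PrimeModulus f → Fixes (q ℕ.^ n) f → Carmichael f
  carmichael⇐ {n} {f} mf ¬prime fix = q ℕ.^ n , quotient-card mf , ¬prime , λ a →
    ≡.subst (λ z → z ≡ a [mod f ]) (≡.sym (Mod-^ f a (q ℕ.^ n))) (fix a)

  carmichael-resp : ∀ {n f g} → Monic n f → f ≈ g → Carmichael f → Carmichael g
  carmichael-resp {n} mf f≈g carm = let (¬prime , fix) = carmichael⇒ mf carm in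
    carmichael⇐ (monic-resp f≈g mf)
      (¬prime ∘ prime-resp (1# , trans (*-identityˡ _) (sym f≈g)) (1# , trans (*-identityˡ _) f≈g))
      (fixes-∣ (q ℕ.^ n) (1# , trans (*-identityˡ _) (sym f≈g)) fix)

  fixes-by-1 : ∀ e → Fixes e 1#
  fixes-by-1 e a = a ^ e - a , *-identityʳ _

  -- Powers respect congruence, so the q ^ n residues are the only elements to test.
  fixes? : ∀ {n f} → Monic n f → ∀ e → Dec (Fixes e f)
  fixes? {n} {f} mf e = map′ extend (λ fix i → fix (residue n i))
    (Fin.all? λ i → divides? (residue n i ^ e - residue n i))
    where
    open Remainder mf
    extend : (∀ i → residue n i ^ e ≡ residue n i [mod f ]) → Fixes e f
    extend h a = Mod.trans f (^-cong-mod e a≡r) (Mod.trans f (h i) (Mod.sym f a≡r))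
      where
      i : Fin (q ℕ.^ n)
      i = encode n (rem a)
      a≡r : a ≡ residue n i [mod f ]
      a≡r = Mod.trans f (rem-≡ a) (≈⇒≡ (sym (residue-encode (rem-low a))))

  carmichael? : ∀ {n f} → Monic n f → Dec (Carmichael f)
  carmichael? {n} mf = map′ (uncurry (carmichael⇐ mf)) (carmichael⇒ mf)
    (¬? (prime? mf) ×-dec fixes? mf (q ℕ.^ n))

  prime-fixes : ∀ {d n P} → d ℕ.∣ n → Monic d P → PrimeModulus P → Fixes (q ℕ.^ n) P
  prime-fixes {d} {n} {P} d∣n mP prime = fixes-∣-exponent q d∣n λ a →
    ≡.subst (λ z → z ≡ a [mod P ]) (Mod-^ P a (q ℕ.^ d))
      (Fermat.fermat (Quotient.quotientRing R P) prime (quotient-card mP) a)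

  carmichael-* : ∀ {d e n P s} → d ℕ.∣ n → d ℕ.+ e ≡ n → 0 ℕ.< e → Monic d P → PrimeModulus P →
    Monic e s → Fixes (q ℕ.^ n) s → P ∤ s → Monic n (P * s) × Carmichael (P * s)
  carmichael-* {d} {e} d∣n ≡.refl 0<e mP prime ms fix P∤s = m , carmichael⇐ m
    (split⇒¬prime m (d , e , _ , _ , prime-degree>0 mP prime , 0<e , ≡.refl , mP , ms , refl))
    (fixes-prime-* (q ℕ.^ (d ℕ.+ e)) prime P∤s (prime-fixes d∣n mP prime) fix)
    where
    m : Monic (d ℕ.+ e) _
    m = monic-* mP ms

  module AllMonic n = Enumeration setoid (λ f → Monic n f × Carmichael f)

  carmichaels : ℕ → List Carrier
  carmichaels n = map (monic n) (filter (λ i → carmichael? (monic-monic n i)) (allFin (q ℕ.^ n)))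

  distinct-monic : ∀ n {p} {P : Pred (Fin (q ℕ.^ n)) p} (P? : Decidable P) →
                   AllPairs _≉_ (map (monic n) (filter P? (allFin (q ℕ.^ n))))
  distinct-monic n P? = AllPairs.map⁺ (AllPairs.map (λ i≢j e → i≢j (monic-injective e))
    (AllPairs.filter⁺ P? (Unique.allFin⁺ _)))
    where
    monic-injective : ∀ {i j} → monic n i ≈ monic n j → i ≡ j
    monic-injective {i} {j} e =
      ≡.trans (≡.sym (encode-monic n i)) (≡.trans (encode-cong n e) (encode-monic n j))

  carmichaels-complete : ∀ n f → Monic n f × Carmichael f → Any (f ≈_) (carmichaels n)
  carmichaels-complete n f (mf , carm) = Any.map (λ { ≡.refl → sym (monic-encode mf) })
    (∈-map⁺ (monic n) (∈-filter⁺ (λ i → carmichael? (monic-monic n i)) (∈-allFin (encode n f))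
      (carmichael-resp mf (sym (monic-encode mf)) carm)))

  carmichaels-sound : ∀ n → All (λ f → Monic n f × Carmichael f) (carmichaels n)
  carmichaels-sound n = All.map⁺ (All.map (λ carm → monic-monic n _ , carm)
    (All.all-filter (λ i → carmichael? (monic-monic n i)) (allFin _)))

  carmichaelCount : ℕ → ℕ
  carmichaelCount n = length (carmichaels n)

  -- For the polynomial ring this `subsetoid` unfolds to `MonicCarmichael F n`.
  carmichael-card : ∀ n → AllMonic.subsetoid n HasCardinality carmichaelCount n
  carmichael-card n = AllMonic.enumeration n (carmichaels-complete n) (carmichaels-sound n)
    (distinct-monic n λ i → carmichael? (monic-monic n i))

  carmichaelCount≥ : ∀ {n} {fs : List Carrier} → All (λ f → Monic n f × Carmichael f) fs → AllPairs _≉_ fs →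
                     length fs ℕ.≤ carmichaelCount n
  carmichaelCount≥ {n} = AllMonic.length≤ n (carmichaels-complete n)

  carmichaelCount≡0 : ∀ n → (∀ {f} → Monic n f → ¬ Carmichael f) → carmichaelCount n ≡ 0
  carmichaelCount≡0 n none with carmichaels n | carmichaels-sound n
  ... | []    | _              = ≡.refl
  ... | _ ∷ _ | (m , carm) ∷ _ = ⊥-elim (none m carm)

  carmichaelCount≤1 : ∀ n {w} → (∀ {f} → Monic n f → Carmichael f → f ≈ w) → carmichaelCount n ℕ.≤ 1
  carmichaelCount≤1 n unique with carmichaels n | carmichaels-sound n | distinct-monic n (λ i → carmichael? (monic-monic n i))
  ... | []        | _ | _ = z≤n
  ... | _ ∷ []    | _ | _ = ℕ.≤-refl
  ... | _ ∷ _ ∷ _ | (m , carm) ∷ (m′ , carm′) ∷ _ | (≉ ∷ _) ∷ _ =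
    ⊥-elim (≉ (trans (unique m carm) (sym (unique m′ carm′))))

  -- Every prime factor P of f has degree d < n and is fixed by the exponents q ^ d and q ^ n,
  -- hence by q ^ p; and f is squarefree.
  carmichael-fixes : ∀ {n f} p → (∀ d → 0 ℕ.< d → d ℕ.< n → gcd d n ℕ.∣ p) → 0 ℕ.< n →
                     Monic n f → Carmichael f → Fixes (q ℕ.^ p) f
  carmichael-fixes {n} {f} p gcd∣p 0<n mf carm = <-rec _ step n mf ∣-refl
    where
    ¬prime : ¬ PrimeModulus f
    ¬prime = proj₁ (carmichael⇒ mf carm)
    fix : Fixes (q ℕ.^ n) f
    fix = proj₂ (carmichael⇒ mf carm)
    2≤qⁿ : 2 ℕ.≤ q ℕ.^ n
    2≤qⁿ = ℕ.≤-trans (ℕ.≤-reflexive (≡.sym (≡.trans (ℕ.^-identityʳ 2) ≡.refl)))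
             (ℕ.≤-trans (ℕ.^-monoʳ-≤ 2 0<n) (ℕ.^-monoˡ-≤ n 1<q))
    step : ∀ e → (∀ {e′} → e′ ℕ.< e → ∀ {g} → Monic e′ g → g ∣ f → Fixes (q ℕ.^ p) g) →
           ∀ {g} → Monic e g → g ∣ f → Fixes (q ℕ.^ p) g
    step zero rec mg g∣f = fixes-∣ (q ℕ.^ p) (1# , trans (*-identityˡ _) (monic-0⇒1 mg)) (fixes-by-1 (q ℕ.^ p))
    step (suc e) rec {g} mg g∣f with prime-factor (suc e) (s≤s z≤n) mg
    ... | d , e′ , P , s , prime , d+e′≡e , mP , ms , Ps≈g =
      fixes-∣ (q ℕ.^ p) (1# , trans (*-identityˡ g) (sym Ps≈g)) (fixes-prime-* (q ℕ.^ p) prime P∤s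
        (fixes-∣-exponent q (gcd∣p d 0<d d<n) (fixes-gcd q d n (prime-fixes ℕ.∣-refl mP prime) (fixes-∣ (q ℕ.^ n) P∣f fix)))
        (rec e′<e ms (∣-trans (P , Ps≈g) g∣f)))
      where
      0<d : 0 ℕ.< d
      0<d = prime-degree>0 mP prime
      e′<e : e′ ℕ.< suc e
      e′<e = ≡.subst (e′ ℕ.<_) d+e′≡e (ℕ.m<n+m e′ 0<d)
      P∣f : P ∣ f
      P∣f = ∣-trans (s , trans (*-comm s P) Ps≈g) g∣f
      -- A prime factor of degree n would equal f, which is not prime. This excludes the value d =
      -- n, for which the gcd is n itself.
      d<n : d ℕ.< n
      d<n = ℕ.≤∧≢⇒< (monic-∣-degree mP mf P∣f) λ { ≡.refl → ¬prime (prime-resp P∣f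
        (1# , trans (*-identityˡ f) (sym (monic-∣-≈ mP mf P∣f))) prime) }
      -- Otherwise P * P divides f and hence P, against degrees. The exponent q ^ n is written as 2
      -- + (q ^ n - 2) for `square-∣-fixes`.
      P∤s : P ∤ s
      P∤s P∣s = ℕ.<⇒≱ (ℕ.m<m+n d 0<d) (monic-∣-degree (monic-* mP mP) mP
        (square-∣-fixes (q ℕ.^ n ℕ.∸ 2) (≡.subst (λ k → Fixes k f) (≡.sym (ℕ.m+[n∸m]≡n 2≤qⁿ)) fix)
          (∣-trans (∣-respʳ (trans (*-comm s P) Ps≈g) (*-monoʳ-∣ P P∣s)) g∣f)))

  -- Any monic `t` of degree one serves: a modulus fixed by Q divides w = t ^ Q - t, whose degree is
  -- Q because 1 < Q.
  fixed-divide : ∀ {Q} → 1 ℕ.< Q → ∃ λ w → Monic Q w × (∀ {f} → Fixes Q f → f ∣ w)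
  fixed-divide {Q} 1<Q = t ^ Q - t
    , monic-+-low (≡.subst (λ k → Monic k (t ^ Q)) (ℕ.*-identityʳ Q) (monic-^ mt Q)) (low-neg (monic⇒low 1<Q mt))
    , λ fix → fix t
    where
    t : Carrier
    t = monic 1 (encode 1 0#)
    mt : Monic 1 t
    mt = monic-monic 1 _

  -- Products of distinct primes

  primes : ℕ → List Carrier
  primes d = map (monic d) (filter (primeAt? d) (allFin (q ℕ.^ d)))

  length-primes : ∀ d → length (primes d) ≡ primeCount d
  length-primes d = ≡.trans (List.length-map (monic d) (filter (primeAt? d) (allFin (q ℕ.^ d)))) (length-filter-tabulate (primeAt? d) (λ i → i))

  PrimeOfDegree : ℕ → Carrier → Set (c ⊔ ℓ)
  PrimeOfDegree d P = Monic d P × PrimeModulus P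

  primes-sound : ∀ d → All (PrimeOfDegree d) (primes d)
  primes-sound d = All.map⁺ (All.map (λ prime → monic-monic d _ , prime) (All.all-filter (primeAt? d) (allFin _)))

  primes-distinct : ∀ d → AllPairs _≉_ (primes d)
  primes-distinct d = distinct-monic d (primeAt? d)

  -- The terms of the k-th elementary symmetric polynomial; the recursion on whether x is used is
  -- Pascal's rule, the same as in `binomial`.
  products : ℕ → List Carrier → List Carrier
  products zero    xs       = 1# ∷ []
  products (suc k) []       = []
  products (suc k) (x ∷ xs) = map (x *_) (products k xs) ++ products (suc k) xs

  length-products : ∀ k xs → length (products k xs) ≡ binomial (length xs) k
  length-products zero    xs       = ≡.refl
  length-products (suc k) []       = ≡.refl
  length-products (suc k) (x ∷ xs) = ≡.trans (List.length-++ (map (x *_) (products k xs)))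
    (≡.cong₂ ℕ._+_ (≡.trans (List.length-map (x *_) (products k xs)) (length-products k xs)) (length-products (suc k) xs))

  module _ {m : ℕ} where

    products-coprime : ∀ k {xs x} → All (PrimeOfDegree m) xs → PrimeOfDegree m x → All (x ≉_) xs →
                       All (x ∤_) (products k xs)
    products-coprime zero _ (mx , prime) _ =
      (λ x∣1 → ℕ.<⇒≱ (prime-degree>0 mx prime) (monic-∣-degree mx monic-1 x∣1)) ∷ []
    products-coprime (suc k) [] _ _ = []
    products-coprime (suc k) ((my , primey) ∷ ps) (mx , prime) (x≉y ∷ x∉) = All.++⁺
      (All.map⁺ (All.map (λ x∤g → x∤g ∘ euclid prime (x≉y ∘ prime-∣-prime mx my prime primey))
                         (products-coprime k ps (mx , prime) x∉)))
      (products-coprime (suc k) ps (mx , prime) x∉)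

    -- Among products containing x, cancel x; a product with x differs from one without it because x
    -- divides only the former.
    products-distinct : ∀ k {xs} → All (PrimeOfDegree m) xs → AllPairs _≉_ xs → AllPairs _≉_ (products k xs)
    products-distinct zero    _ _ = [] ∷ []
    products-distinct (suc k) [] _ = []
    products-distinct (suc k) {x ∷ xs} (p@(mx , _) ∷ ps) (x∉ ∷ d) = AllPairs.++⁺
      (AllPairs.map⁺ (AllPairs.map (λ u≉v e → u≉v (monic-cancelʳ mx (trans (*-comm _ x) (trans e (*-comm x _)))))
                                   (products-distinct k ps d)))
      (products-distinct (suc k) ps d)
      (All.map⁺ (All.universal (λ u → All.map (λ x∤g e → x∤g (u , trans (*-comm u x) e))
                                              (products-coprime (suc k) ps p x∉)) _))

    products-fixed : ∀ {n} → m ℕ.∣ n → ∀ k {xs} → All (PrimeOfDegree m) xs → AllPairs _≉_ xs →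
                     All (λ g → Monic (k ℕ.* m) g × Fixes (q ℕ.^ n) g) (products k xs)
    products-fixed {n} m∣n zero    _  _ = (monic-1 , fixes-by-1 (q ℕ.^ n)) ∷ []
    products-fixed m∣n (suc k) [] _ = []
    products-fixed {n} m∣n (suc k) (p@(mx , prime) ∷ ps) (x∉ ∷ d) = All.++⁺
      (All.map⁺ (All.zipWith
        (λ { ((mg , fix) , x∤g) → monic-* mx mg , fixes-prime-* (q ℕ.^ n) prime x∤g (prime-fixes m∣n mx prime) fix })
        (products-fixed m∣n k ps d , products-coprime k ps p x∉)))
      (products-fixed m∣n (suc k) ps d)

    -- With at least two factors, splitting off the first leaves a cofactor of positive degree, so
    -- the quotient is not a field.
    products-carmichael : ∀ k {xs} → All (PrimeOfDegree m) xs → AllPairs _≉_ xs →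
      All (λ g → Monic ((2 ℕ.+ k) ℕ.* m) g × Carmichael g) (products (2 ℕ.+ k) xs)
    products-carmichael k [] _ = []
    products-carmichael k (p@(mx , prime) ∷ ps) (x∉ ∷ d) = All.++⁺
      (All.map⁺ (All.zipWith
        (λ { ((mg , fix) , x∤g) → carmichael-* m∣n ≡.refl
               (ℕ.<-≤-trans (prime-degree>0 mx prime) (ℕ.m≤m+n m (k ℕ.* m))) mx prime mg fix x∤g })
        (products-fixed m∣n (suc k) ps d , products-coprime (suc k) ps p x∉)))
      (products-carmichael k ps d)
      where
      m∣n : m ℕ.∣ (2 ℕ.+ k) ℕ.* m
      m∣n = ℕ.divides (2 ℕ.+ k) ≡.refl

  carmichaelCount-binomial : ∀ k m → binomial (primeCount m) (2 ℕ.+ k) ℕ.≤ carmichaelCount ((2 ℕ.+ k) ℕ.* m)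
  carmichaelCount-binomial k m = ≡.subst (ℕ._≤ carmichaelCount ((2 ℕ.+ k) ℕ.* m))
    (≡.trans (length-products (2 ℕ.+ k) (primes m)) (≡.cong (λ N → binomial N (2 ℕ.+ k)) (length-primes m)))
    (carmichaelCount≥ (products-carmichael k (primes-sound m) (primes-distinct m))
                      (products-distinct (2 ℕ.+ k) (primes-sound m) (primes-distinct m)))

  one-prime : ∀ d → 1 ℕ.≤ primeCount d → ∃ (PrimeOfDegree d)
  one-prime d 1≤N with primes d | primes-sound d | ≡.subst (1 ℕ.≤_) (≡.sym (length-primes d)) 1≤N
  ... | x ∷ _ | p ∷ _ | _ = x , p

  two-primes : ∀ d → 2 ℕ.≤ primeCount d →
               ∃₂ λ P Q → PrimeOfDegree d P × PrimeOfDegree d Q × P ≉ Q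
  two-primes d 2≤N with primes d | primes-sound d | primes-distinct d | ≡.subst (2 ℕ.≤_) (≡.sym (length-primes d)) 2≤N
  ... | _ ∷ []    | _         | _           | s≤s ()
  ... | x ∷ y ∷ _ | p ∷ r ∷ _ | (x≉y ∷ _) ∷ _ | _ = x , y , p , r , x≉y

  prime-∤-degree : ∀ {d e P Q} → PrimeOfDegree d P → PrimeOfDegree e Q → d ≢ e → P ∤ Q
  prime-∤-degree (mP , p) (mQ , r) d≢e P∣Q =
    d≢e (monic-degree-unique (monic-resp (prime-∣-prime mP mQ p r P∣Q) mP) mQ)

  -- Over two elements there is one prime of degree 2, too few for a product of two. The degrees 1 +
  -- 1 + 2, all divisors of 4, are used instead.
  carmichaelCount-4 : 2 ℕ.≤ primeCount 1 → 1 ℕ.≤ primeCount 2 → 1 ℕ.≤ carmichaelCount 4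
  carmichaelCount-4 N₁ N₂ with two-primes 1 N₁ | one-prime 2 N₂
  ... | x , y , px@(mx , primex) , py@(my , primey) , x≉y | Q , pQ@(mQ , primeQ) = carmichaelCount≥
    (carmichael-* (ℕ.divides 4 ≡.refl) ≡.refl (s≤s z≤n) mx primex (monic-* my mQ)
      (fixes-prime-* (q ℕ.^ 4) primey y∤Q (prime-fixes (ℕ.divides 4 ≡.refl) my primey) (prime-fixes (ℕ.divides 2 ≡.refl) mQ primeQ))
      (λ x∣yQ → prime-∤-degree px pQ (λ ()) (euclid primex (x≉y ∘ prime-∣-prime mx my primex primey) x∣yQ))
      ∷ [])
    ([] ∷ [])
    where
    y∤Q : y ∤ Q
    y∤Q = prime-∤-degree py pQ λ ()

  -- The two witnesses have prime factors of degrees 1 + 2 + 3 and 3 + 3; the linear prime tells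
  -- them apart.
  carmichaelCount-6 : 1 ℕ.≤ primeCount 1 → 1 ℕ.≤ primeCount 2 → 2 ℕ.≤ primeCount 3 → 2 ℕ.≤ carmichaelCount 6
  carmichaelCount-6 N₁ N₂ N₃ with one-prime 1 N₁ | one-prime 2 N₂ | two-primes 3 N₃
  ... | x , px@(mx , primex) | y , py@(my , primey) | P , Q , pP@(mP , primeP) , pQ@(mQ , primeQ) , P≉Q = carmichaelCount≥
    ( carmichael-* (ℕ.divides 6 ≡.refl) ≡.refl (s≤s z≤n) mx primex (monic-* my mP)
        (fixes-prime-* (q ℕ.^ 6) primey (prime-∤-degree py pP λ ())
          (prime-fixes (ℕ.divides 3 ≡.refl) my primey) (prime-fixes (ℕ.divides 2 ≡.refl) mP primeP))
        (prime-∤-degree px pP (λ ()) ∘ euclid primex (prime-∤-degree px py λ ()))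
    ∷ carmichael-* (ℕ.divides 2 ≡.refl) ≡.refl (s≤s z≤n) mP primeP mQ (prime-fixes (ℕ.divides 2 ≡.refl) mQ primeQ)
        (P≉Q ∘ prime-∣-prime mP mQ primeP primeQ)
    ∷ [])
    (((λ e → x∤PQ (y * P , trans (*-comm _ x) e)) ∷ []) ∷ [] ∷ [])
    where
    x∤PQ : x ∤ P * Q
    x∤PQ = prime-∤-degree px pQ (λ ()) ∘ euclid primex (prime-∤-degree px pP λ ())

-- The estimates for composite degree

module CompositeDegree where
  open import Data.Nat.Base
  open import Data.Nat.Properties
  open ≡
  open import Data.Nat.Divisibility
  open import Data.Nat.ListAction using (product)

  half : ∀ m → ∃ λ h → h + h ≤ m × m < suc h + suc h
  half zero          = 0 , z≤n , s≤s z≤n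
  half (suc zero)    = 0 , z≤n , s≤s (s≤s z≤n)
  half (suc (suc m)) = let (h , lo , hi) = half m in
    suc h , s≤s (subst (_≤ suc m) (sym (+-suc h h)) (s≤s lo))
          , s≤s (subst (suc (suc m) ≤_) (sym (+-suc (suc h) (suc h))) (s≤s hi))

  -- This is (x - 2)² ≥ 0 without subtraction; with x = q ^ h it absorbs the error term of the prime
  -- count.
  4x≤xx+4 : ∀ x → 4 * x ≤ x * x + 4
  4x≤xx+4 zero          = z≤n
  4x≤xx+4 (suc zero)    = s≤s (s≤s (s≤s (s≤s z≤n)))
  4x≤xx+4 (suc (suc y)) = subst (4 * (2 + y) ≤_) (expand y) (m≤m+n _ (y * y))
    where
    expand : ∀ y → 4 * (2 + y) + y * y ≡ (2 + y) * (2 + y) + 4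
    expand = solve-∀

  -- Doubling the bound gives 2 m N ≥ 2 q ^ m + 4 - 4 q ^ h, and 4 q ^ h ≤ q ^ (2 h) + 4 ≤ q ^ m +
  -- 4.
  density : ∀ q .{{_ : NonZero q}} m h N → h + h ≤ m → q ^ m + 2 ≤ N * m + 2 * q ^ h → q ^ m ≤ 2 * m * N
  density q m h N 2h≤m bound = +-cancelʳ-≤ (q ^ m + 4) (q ^ m) (2 * m * N) (begin
    q ^ m + (q ^ m + 4)            ≡⟨ regroup (q ^ m) ⟩
    2 * (q ^ m + 2)                ≤⟨ *-monoʳ-≤ 2 bound ⟩
    2 * (N * m + 2 * q ^ h)        ≡⟨ expand N m (q ^ h) ⟩
    2 * m * N + 4 * q ^ h          ≤⟨ +-monoʳ-≤ (2 * m * N) (begin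
      4 * q ^ h              ≤⟨ 4x≤xx+4 (q ^ h) ⟩
      q ^ h * q ^ h + 4      ≡⟨ cong (_+ 4) (sym (^-distribˡ-+-* q h h)) ⟩
      q ^ (h + h) + 4        ≤⟨ +-monoˡ-≤ 4 (^-monoʳ-≤ q 2h≤m) ⟩
      q ^ m + 4              ∎) ⟩
    2 * m * N + (q ^ m + 4)        ∎)
    where
    open ≤-Reasoning
    regroup : ∀ x → x + (x + 4) ≡ 2 * (x + 2)
    regroup = solve-∀
    expand : ∀ N m x → 2 * (N * m + 2 * x) ≡ 2 * m * N + 4 * x
    expand = solve-∀

  -- Since q ^ m ≤ 2 m N, the inequality 2 m² < q ^ m forces m < N. It holds for base 3 from m = 2
  -- on (8 < 9), but for base 2 only from m = 7 on (98 < 128, while 72 > 64), so smaller m are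
  -- treated singly over two elements.
  square<3^ : ∀ k → 2 * ((2 + k) * (2 + k)) < 3 ^ (2 + k)
  square<3^ zero    = ≤-refl
  square<3^ (suc k) = ≤-<-trans
    (subst (2 * ((3 + k) * (3 + k)) ≤_) (expand k) (m≤m+n _ (4 * (k * k) + 12 * k + 6)))
    (*-monoʳ-< 3 (square<3^ k))
    where
    expand : ∀ k → 2 * ((3 + k) * (3 + k)) + (4 * (k * k) + 12 * k + 6) ≡ 3 * (2 * ((2 + k) * (2 + k)))
    expand = solve-∀

  square<2^ : ∀ k → 2 * ((7 + k) * (7 + k)) < 2 ^ (7 + k)
  square<2^ zero    = m≤m+n 99 29
  square<2^ (suc k) = ≤-<-trans
    (subst (2 * ((8 + k) * (8 + k)) ≤_) (expand k) (m≤m+n _ (2 * (k * k) + 24 * k + 68)))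
    (*-monoʳ-< 2 (square<2^ k))
    where
    expand : ∀ k → 2 * ((8 + k) * (8 + k)) + (2 * (k * k) + 24 * k + 68) ≡ 2 * (2 * ((7 + k) * (7 + k)))
    expand = solve-∀

  module Counting (q : ℕ) (1<q : 1 < q) (N : ℕ → ℕ)
    (bound : ∀ m h → suc m < suc h + suc h → h ≤ m → q ^ suc m + 2 ≤ N (suc m) * suc m + 2 * q ^ h) where

    private instance
      q≢0 : NonZero q
      q≢0 = >-nonZero (<-trans (s≤s z≤n) 1<q)

    count-dense : ∀ m → 0 < m → q ^ m ≤ 2 * m * N m
    count-dense (suc m) _ = let (h , lo , hi) = half (suc m) in
      density q (suc m) h (N (suc m)) lo (bound m h hi (h≤ h lo))
      where
      h≤ : ∀ h → h + h ≤ suc m → h ≤ m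
      h≤ zero    _        = z≤n
      h≤ (suc h) (s≤s lo) = ≤-trans (m≤n+m (suc h) h) lo

    large : ∀ m → 0 < m → 2 * (m * m) < q ^ m → m < N m
    large m 0<m lt = *-cancelˡ-< (2 * m) m (N m)
      (<-≤-trans (subst (_< q ^ m) (sym (*-assoc 2 m m)) lt) (count-dense m 0<m))

    Classification : ℕ → ℕ → Set
    Classification l m = l < N m ⊎ q ≡ 2 × l ≡ 2 × m ≡ 2 ⊎ q ≡ 2 × l ≡ 2 × m ≡ 3 ⊎ q ≡ 2 × l ≡ 3 × m ≡ 3

    -- In most cases even m < N m holds, and l ≤ m finishes. For q = 2 there are one prime of degree
    -- 2 and two of degree 3, whence the exceptions. The condition on even m serves m = 4, where l =
    -- 3 and l = 4 would have to be exceptions too.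
    classify : ∀ l m → 1 < l → l ≤ m → (2 ∣ m → l ≤ 2) → Classification l m
    classify l m 1<l l≤m even with m≤n⇒m<n∨m≡n 1<q
    ... | inj₁ 2<q = inj₁ (≤-<-trans l≤m (large m (<-trans (s≤s z≤n) 1<m)
      (<-≤-trans (subst (λ m → 2 * (m * m) < 3 ^ m) (m+[n∸m]≡n 1<m) (square<3^ (m ∸ 2))) (^-monoˡ-≤ m 2<q))))
      where
      1<m : 1 < m
      1<m = <-≤-trans 1<l l≤m
    ... | inj₂ refl = binary m l 1<l l≤m even
      where
      binary : ∀ m l → 1 < l → l ≤ m → (2 ∣ m → l ≤ 2) → Classification l m
      binary 0 l (s≤s _) () _
      binary 1 l (s≤s (s≤s _)) (s≤s ()) _
      binary 2 l 1<l l≤m _ = inj₂ (inj₁ (refl , ≤-antisym l≤m 1<l , refl))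
      binary 3 2 _ _ _ = inj₂ (inj₂ (inj₁ (refl , refl , refl)))
      binary 3 3 _ _ _ = inj₂ (inj₂ (inj₂ (refl , refl , refl)))
      binary 3 0 () _ _
      binary 3 1 (s≤s ()) _ _
      binary 3 (suc (suc (suc (suc _)))) _ (s≤s (s≤s (s≤s ()))) _
      -- For m = 4, 5, 6 the bound with h = 2, 2, 3 gives 10 ≤ 4 N 4, 26 ≤ 5 N 5 and 50 ≤ 6 N 6,
      -- hence N 4 > 2, N 5 > 5 and N 6 > 6.
      binary 4 l _ _ even = inj₁ (≤-<-trans (even (divides 2 refl))
        (*-cancelʳ-< 4 2 (N 4) (<-≤-trans (m≤m+n 9 1) (+-cancelʳ-≤ 8 10 (N 4 * 4) (bound 3 2 (m≤m+n 5 1) (m≤m+n 2 1))))))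
      binary 5 l _ l≤5 _ = inj₁ (≤-<-trans l≤5
        (*-cancelʳ-< 5 5 (N 5) (<-≤-trans (m≤m+n 26 0) (+-cancelʳ-≤ 8 26 (N 5 * 5) (bound 4 2 (m≤m+n 6 0) (m≤m+n 2 2))))))
      binary 6 l _ l≤6 _ = inj₁ (≤-<-trans l≤6
        (*-cancelʳ-< 6 6 (N 6) (<-≤-trans (m≤m+n 37 13) (+-cancelʳ-≤ 16 50 (N 6 * 6) (bound 5 3 (m≤m+n 7 1) (m≤m+n 3 2))))))
      binary (suc (suc (suc (suc (suc (suc (suc k))))))) l _ l≤m _ =
        inj₁ (≤-<-trans l≤m (large (7 + k) (s≤s z≤n) (square<2^ k)))

    -- The l-th power of `count-dense` meets (N / l) ^ l ≤ `binomial N l`; the factors (2 m) ^ l and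
    -- l ^ l combine to (2 n) ^ l.
    binomial-bound : ∀ l m → 0 < m → l ≤ N m → q ^ (m * l) ≤ binomial (N m) l * (2 * (m * l)) ^ l
    binomial-bound l m 0<m l≤N = begin
      q ^ (m * l)                          ≡⟨ sym (^-*-assoc q m l) ⟩
      (q ^ m) ^ l                          ≤⟨ ^-monoˡ-≤ l (count-dense m 0<m) ⟩
      (2 * m * N m) ^ l                    ≡⟨ ^-distrib-* (2 * m) (N m) l ⟩
      (2 * m) ^ l * N m ^ l                ≤⟨ *-monoʳ-≤ ((2 * m) ^ l) (^≤^*binomial l (N m) l≤N) ⟩
      (2 * m) ^ l * (l ^ l * B)            ≡⟨ regroup ((2 * m) ^ l) (l ^ l) B ⟩
      B * ((2 * m) ^ l * l ^ l)            ≡⟨ cong (B *_) (sym (^-distrib-* (2 * m) l l)) ⟩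
      B * (2 * m * l) ^ l                  ≡⟨ cong (λ z → B * z ^ l) (*-assoc 2 m l) ⟩
      B * (2 * (m * l)) ^ l                ∎
      where
      open ≤-Reasoning
      B : ℕ
      B = binomial (N m) l
      regroup : ∀ x y z → x * (y * z) ≡ z * (x * y)
      regroup = solve-∀

  fraction-≤ : ∀ a b c .{{_ : NonZero b}} → a ≤ c * b → ℤ.+ a ℚ./ b ℚ.≤ ℤ.+ c ℚ./ 1
  fraction-≤ a (suc b) c a≤cb = ℚ.toℚᵘ-cancel-≤
    (ℚᵘ.≤-respˡ-≃ (ℚᵘ.≃-sym (ℚ.toℚᵘ-fromℚᵘ (ℚᵘ.mkℚᵘ (ℤ.+ a) b)))
    (ℚᵘ.≤-respʳ-≃ (ℚᵘ.≃-sym (ℚ.toℚᵘ-fromℚᵘ (ℚᵘ.mkℚᵘ (ℤ.+ c) 0)))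
    (ℚᵘ.*≤* (subst₂ ℤ._≤_ (ℤ.pos-* a 1) (ℤ.pos-* c (suc b))
      (ℤ.+≤+ (≤-trans (≤-reflexive (*-identityʳ a)) a≤cb))))))

  prime-divisor : ∀ m → 1 < m → ∃ λ p → Prime p × p ∣ m
  prime-divisor m 1<m with factorise m {{>-nonZero (<-trans (s≤s z≤n) 1<m)}}
  ... | record { factors = [] ; isFactorisation = m≡1 } = ⊥-elim (<-irrefl (sym m≡1) 1<m)
  ... | record { factors = p ∷ ps ; isFactorisation = e ; factorsPrime = isPrime ∷ _ } =
    p , isPrime , divides (product ps) (trans e (*-comm p _))

  -- Degrees 4 and 9 over the field with two elements

  module BinaryExceptions {c ℓ} {R : CommutativeRing c ℓ} (T : DegreeTheory R 2) where
    open PrimeElements T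
    open CarmichaelElements T

    count-9 : carmichaelCount 9 ≡ 0
    count-9 = carmichaelCount≡0 9 λ mf carm →
      -- f of degree 9 would divide w of degree 8.
      let (w , mw , fixed∣w) = fixed-divide {2 ^ 3} (m≤m+n 2 6)
      in <⇒≱ (m≤m+n 9 0) (monic-∣-degree mf mw (fixed∣w (carmichael-fixes 3 gcd∣3 (s≤s z≤n) mf carm)))
      where
      gcd∣3 : ∀ d → 0 < d → d < 9 → gcd d 9 ∣ 3
      gcd∣3 d 0<d d<9 = from-yes (allUpTo? (λ d → (0 <? d) →-dec (gcd d 9 ∣? 3)) 9) d<9 0<d

    count-4 : carmichaelCount 4 ≤ 1
    count-4 =
      -- Here w has degree 4 like f, so divisibility between monic elements forces f = w.
      let (w , mw , fixed∣w) = fixed-divide {2 ^ 2} (m≤m+n 2 2)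
      in carmichaelCount≤1 4 {w} λ mf carm →
           monic-∣-≈ mf mw (fixed∣w (carmichael-fixes 2 gcd∣2 (s≤s z≤n) mf carm))
      where
      gcd∣2 : ∀ d → 0 < d → d < 4 → gcd d 4 ∣ 2
      gcd∣2 d 0<d d<4 = from-yes (allUpTo? (λ d → (0 <? d) →-dec (gcd d 4 ∣? 2)) 4) d<4 0<d

  -- q and n are variables so that the equations can be matched, which carries `T` along to q = 2.
  count-2-9 : ∀ {c ℓ q n} {R : CommutativeRing c ℓ} (T : DegreeTheory R q) → q ≡ 2 × n ≡ 9 →
              CarmichaelElements.carmichaelCount T n ≡ 0
  count-2-9 T (refl , refl) = BinaryExceptions.count-9 T

  count-2-4 : ∀ {c ℓ q n} {R : CommutativeRing c ℓ} (T : DegreeTheory R q) → q ≡ 2 × n ≡ 4 →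
              CarmichaelElements.carmichaelCount T n ≤ 1
  count-2-4 T (refl , refl) = BinaryExceptions.count-4 T

  module Count {c ℓ q} {R : CommutativeRing c ℓ} (T : DegreeTheory R q) where
    open DegreeTheory T using (1<q)
    open PrimeElements T using (primeCount; primeCount-bound)
    open CarmichaelElements T
    open Counting q 1<q primeCount primeCount-bound

    binomial≤ : ∀ l m → 1 < l → binomial (primeCount m) l ≤ carmichaelCount (m * l)
    binomial≤ (suc zero)    m (s≤s ())
    binomial≤ (suc (suc k)) m _ = subst (λ n → binomial (primeCount m) (2 + k) ≤ carmichaelCount n)
                                   (*-comm (2 + k) m) (carmichaelCount-binomial k m)

    bound : ∀ l m → 1 < l → 0 < m → l ≤ primeCount m → q ^ (m * l) ≤ carmichaelCount (m * l) * (2 * (m * l)) ^ l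
    bound l m 1<l 0<m l≤N = ≤-trans (binomial-bound l m 0<m l≤N) (*-monoˡ-≤ _ (binomial≤ l m 1<l))

    -- Lower bounds only; the matching upper bounds in the last two cases come from `count-2-4` and
    -- `count-2-9`.
    Trichotomy : ℕ → ℕ → Set
    Trichotomy n l = (2 ≤ carmichaelCount n × q ^ n ≤ carmichaelCount n * (2 * n) ^ l)
                  ⊎ (q ≡ 2 × n ≡ 4) × 1 ≤ carmichaelCount n × q ^ n ≤ carmichaelCount n * (2 * n) ^ l
                  ⊎ (q ≡ 2 × n ≡ 9)

    trichotomy : ∀ l m → 1 < l → l ≤ m → (2 ∣ m → l ≤ 2) → Trichotomy (m * l) l
    trichotomy l m 1<l l≤m even = go 1<l l≤m (classify l m 1<l l≤m even)
      where
      -- For q = 2 the prime count bound reads 4 ≤ N 1 + 2, 6 ≤ 2 N 2 + 4 and 10 ≤ 3 N 3 + 4.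
      small₁ : q ≡ 2 → 2 ≤ primeCount 1
      small₁ q≡2 = +-cancelʳ-≤ 2 2 (primeCount 1) (≤-trans
        (≤-reflexive (sym (cong (λ q → q ^ 1 + 2) q≡2)))
        (≤-trans (primeCount-bound 0 0 (s≤s (s≤s z≤n)) z≤n) (≤-reflexive (cong (_+ 2) (*-identityʳ (primeCount 1))))))
      small₂ : q ≡ 2 → 1 ≤ primeCount 2
      small₂ q≡2 = *-cancelʳ-≤ 1 (primeCount 2) 2 (+-cancelʳ-≤ 4 2 (primeCount 2 * 2)
        (subst (λ q → q ^ 2 + 2 ≤ primeCount 2 * 2 + 2 * q ^ 1) q≡2 (primeCount-bound 1 1 (m≤m+n 3 1) ≤-refl)))
      small₃ : q ≡ 2 → 2 ≤ primeCount 3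
      small₃ q≡2 = *-cancelʳ-≤ 2 (primeCount 3) 3 (+-cancelʳ-≤ 4 6 (primeCount 3 * 3)
        (subst (λ q → q ^ 3 + 2 ≤ primeCount 3 * 3 + 2 * q ^ 1) q≡2 (primeCount-bound 2 1 (m≤m+n 4 0) (m≤m+n 1 1))))

      go : ∀ {l m} → 1 < l → l ≤ m → Classification l m → Trichotomy (m * l) l
      go {l} {m} 1<l l≤m (inj₁ l<N) = inj₁
        ( ≤-trans (<⇒≤ (<-≤-trans (s≤s 1<l) l<N))
            (≤-trans (n≤binomial l (primeCount m) (<⇒≤ 1<l) l<N) (binomial≤ l m 1<l))
        , bound l m 1<l (<-≤-trans (<⇒≤ 1<l) l≤m) (<⇒≤ l<N))
      -- There are fewer than l primes of degree m here, but one Carmichael polynomial suffices for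
      -- the size bound: 16 ≤ 8 ^ 2.
      go _ _ (inj₂ (inj₁ (q≡2 , refl , refl))) = inj₂ (inj₁ ((q≡2 , refl) , 1≤C ,
        ≤-trans (≤-reflexive (cong (_^ 4) q≡2)) (≤-trans (m≤m+n 16 48) (*-monoˡ-≤ (8 ^ 2) 1≤C))))
        where
        1≤C : 1 ≤ carmichaelCount 4
        1≤C = carmichaelCount-4 (small₁ q≡2) (small₂ q≡2)
      -- With N 3 = l = 2 the size bound still follows from l ≤ N, but the binomial coefficient is
      -- 1, so C ≥ 2 needs the extra product of degree 6.
      go 1<l _ (inj₂ (inj₂ (inj₁ (q≡2 , refl , refl)))) = inj₁
        ( carmichaelCount-6 (<⇒≤ (small₁ q≡2)) (small₂ q≡2) (small₃ q≡2)
        , bound 2 3 1<l (s≤s z≤n) (small₃ q≡2))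
      go _ _ (inj₂ (inj₂ (inj₂ (q≡2 , refl , refl)))) = inj₂ (inj₂ (q≡2 , refl))

    count-theorem : ∀ n l → Trichotomy n l → .{{_ : NonZero ((2 * n) ^ l)}} →
        (carmichaelCount n ≡ 0 ⇔ (q ≡ 2 × n ≡ 9))
      × (¬ (q ≡ 2 × n ≡ 9) →
          (carmichaelCount n ≡ 1 ⇔ (q ≡ 2 × n ≡ 4))
          × ℤ.+ (q ^ n) ℚ./ (2 * n) ^ l ℚ.≤ ℤ.+ carmichaelCount n ℚ./ 1)
    count-theorem n l (inj₁ (2≤C , q^n≤)) =
        mk⇔ (λ C≡0 → ⊥-elim (<-irrefl (sym C≡0) (<⇒≤ 2≤C))) (count-2-9 T)
      , λ _ → mk⇔ (λ C≡1 → ⊥-elim (<-irrefl (sym C≡1) 2≤C)) (λ e → ⊥-elim (<⇒≱ 2≤C (count-2-4 T e)))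
            , fraction-≤ (q ^ n) ((2 * n) ^ l) (carmichaelCount n) q^n≤
    count-theorem n l (inj₂ (inj₁ (e , 1≤C , q^n≤))) =
        mk⇔ (λ C≡0 → ⊥-elim (<-irrefl (sym C≡0) 1≤C)) (count-2-9 T)
      , λ _ → mk⇔ (λ _ → e) (λ e → ≤-antisym (count-2-4 T e) 1≤C)
            , fraction-≤ (q ^ n) ((2 * n) ^ l) (carmichaelCount n) q^n≤
    count-theorem n l (inj₂ (inj₂ e)) = mk⇔ (λ _ → e) (count-2-9 T) , λ ¬e → ⊥-elim (¬e e)

    -- A prime factor of the cofactor m also divides n, so it is at least l, which gives l ≤ m; m >
    -- 1 because n is not the prime l. If m is even, leastness against 2 gives l ≤ 2.
    composite-trichotomy : ∀ n l → Composite n → IsSmallestPrimeFactor l n → Trichotomy n l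
    composite-trichotomy n l comp (l-prime , divides m refl , least) = trichotomy l m 1<l l≤m
      (λ 2∣m → least 2 prime[2] (∣-trans 2∣m (m∣m*n l)))
      where
      1<l : 1 < l
      1<l = nonTrivial⇒n>1 l {{prime⇒nonTrivial l-prime}}
      1<m : 1 < m
      1<m = go m comp
        where
        go : ∀ m → Composite (m * l) → 1 < m
        go 0 comp = ⊥-elim (≢-nonZero⁻¹ 0 {{composite⇒nonZero comp}} refl)
        go 1 comp = ⊥-elim (prime⇒¬composite l-prime (subst Composite (*-identityˡ l) comp))
        go (suc (suc m)) _ = s≤s (s≤s z≤n)
      l≤m : l ≤ m
      l≤m = let (p , prime-p , p∣m) = prime-divisor m 1<m in
        ≤-trans (least p prime-p (∣-trans p∣m (m∣m*n l))) (∣⇒≤ {{>-nonZero (<-trans (s≤s z≤n) 1<m)}} p∣m)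

open import Data.Nat.Base using (ℕ; _*_; _^_)
open import Data.Nat.Properties using (m*n≢0; m^n≢0)
open import Data.Nat.Primality using (Composite; composite⇒nonZero)
open import Data.Integer.Base using (+_)
open import Data.Rational.Base using (_/_; _≤_)
open import Data.Product.Base using (∃-syntax; _×_)
open import Function.Bundles using (_⇔_)
open import Relation.Nullary.Negation.Core using (¬_)
open import Relation.Binary.PropositionalEquality using (_≡_)

theorem4p5 : ∀ {c ℓ} {q : ℕ} (F : FiniteField c ℓ q) (n : ℕ) (comp : Composite n)
    (l : ℕ) → IsSmallestPrimeFactor l n →
    let 2n≢0 = m*n≢0 2 n {{_}} {{composite⇒nonZero comp}} in
    ∃[ C ] (MonicCarmichael F n HasCardinality C)
    × (C ≡ 0 ⇔ (q ≡ 2 × n ≡ 9))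
    × (¬ (q ≡ 2 × n ≡ 9) →
    (C ≡ 1 ⇔ (q ≡ 2 × n ≡ 4))
    × _/_ (+ (q ^ n)) ((2 * n) ^ l) {{m^n≢0 (2 * n) l {{2n≢0}}}} ≤ (+ C) / 1)
theorem4p5 F n comp l smallest =
  carmichaelCount n , carmichael-card n ,
  count-theorem n l (composite-trichotomy n l comp smallest) {{m^n≢0 (2 * n) l {{m*n≢0 2 n}}}}
  where
  T = Polynomials.degreeTheory F
  open CarmichaelElements T
  open CompositeDegree.Count T
  instance n≢0 = composite⇒nonZero comp
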